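{- For every nonnegative integer $n$, $\phi_{2,-1}(5n+4)\equiv 0 \pmod 5$.
   Context: $\phi_{2,-1}(n)$ is defined by $\sum_{n\ge0}\phi_{2,-1}(n)q^n=$ the coefficient of $z^{ -1}$ in the formal product $\prod_{\lambda=0}^{\infty}(1+zq^{\lambda+1}+z^2q^{2(\lambda+1)})(1+z^{ -1}q^{\lambda}+z^{ -2}q^{2\lambda})$. Equivalently, $\phi_{2,-1}(n)$ is the number of two-rowed arrays with top row $(a_1\ge\cdots\ge a_{m_1})$ and bottom row $(b_1\ge\cdots\ge b_{m_2})$ of nonnegative integers, with $m_1-m_2=-1$, each nonnegative integer appearing at most twice in each row, and weight $m_1+\sum a_i+\sum b_j=n$. -}

module Defs where

open import Data.Nat using (ℕ; zero; suc; _+_; _∸_; _≤ᵇ_; _≡ᵇ_)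
open import Data.List using (List; []; _∷_; _++_; map; concatMap; filter; length; replicate; upTo)
open import Data.Nat.ListAction using (sum)
open import Data.Product using (_×_; _,_)
open import Data.Bool using (Bool; if_then_else_; true; false)
open import Relation.Nullary.Decidable using (yes; no)
open import Data.Nat.Properties using (_≟_)

-- rowsBelow V k : the list of all rows (a₁ ≥ ⋯ ≥ a_k) of length k with
-- entries in {0,…,V-1}, each value appearing at most twice.
-- The value V-1 is placed j ∈ {0,1,2} times at the front, the rest uses values < V-1.
rowsBelow : ℕ → ℕ → List (List ℕ)
rowsBelow zero zero = [] ∷ []
rowsBelow zero (suc k) = []
rowsBelow (suc V) k =
  concatMap
    (λ j → if j ≤ᵇ k then map (λ r → replicate j V ++ r) (rowsBelow V (k ∸ j)) else [])
    (0 ∷ 1 ∷ 2 ∷ [])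

-- Two-rowed arrays (top row of length m₁, bottom row of length m₂ = m₁ + 1, i.e.
-- m₁ - m₂ = -1) with weight m₁ + Σ aᵢ + Σ bⱼ = n. All entries are ≤ n
-- necessarily, so entries range over {0,…,n}.
arrays : ℕ → List (List ℕ × List ℕ)
arrays n =
  filter (λ { (t , b) → length t + sum t + sum b ≟ n })
    (concatMap
      (λ m₁ → concatMap (λ t → map (λ b → (t , b)) (rowsBelow (suc n) (suc m₁)))
                        (rowsBelow (suc n) m₁))
      (upTo (suc n)))

phi2m1 : ℕ → ℕ
phi2m1 n = length (arrays n)

{-# OPTIONS --safe #-}
module Submission where

-- With ω a primitive cube root of unity, 1 + u + u² = (1 − ωu)(1 − ω⁻¹u), so the product defining φ
-- splits into two Jacobi triple products. Extracting z⁻¹ gives, with E = ∏ (1 − qⁱ),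
--   E² Σ φ(n) qⁿ = Σₖ (−ω)^{2k+1} q^{k(k+1)}.
-- Multiplying by E³ = ½ Σᵢ (−1)ⁱ (2i+1) q^{i(i+1)/2} and reducing modulo 5, where E⁵ is a
-- power series in q⁵, an exponent k(k+1) + i(i+1)/2 ≡ 4 (mod 5) gives
-- 2(2k+1)² + (2i+1)² ≡ 0, which forces 5 ∣ 2i+1 as −2 is not a square modulo 5.
--
-- Everything is computed in R[q]/(q^K) over R = 𝔽₅[x]/(x² − x + 1), where x = −ω. Since −1 is a
-- natural number in R, commutative semirings suffice. The variable q being nilpotent, E is a unit
-- and the infinite products are finite.

open import Defs
open import Algebra using (CommutativeSemiring)
open import Algebra.Structures.Biased using (isCommutativeSemiringˡ)
open import Data.Fin using (Fin; toℕ; fromℕ<)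
open import Data.Fin.Properties using (all?; toℕ-fromℕ<)
open import Data.List using (List; []; _∷_; _++_; map; concatMap; filter; length; upTo; applyUpTo)
import Data.List.Properties as Listₚ
open import Data.Nat as ℕ using (ℕ; zero; suc; s≤s; z≤n)
open import Data.Nat.Divisibility using (_∣_; m%n≡0⇒n∣m)
open import Data.Nat.DivMod
  using (_%_; _/_; m≡m%n+[m/n]*n; [m+kn]%n≡m%n; m%n<n; m%n%n≡m%n; m*n%n≡0; %-distribˡ-+; %-distribˡ-*)
open import Data.Nat.ListAction using (sum)
import Data.Nat.Properties as ℕₚ
open import Data.Nat.Tactic.RingSolver using (solve-∀)
open import Data.Product using (_,_; proj₁; proj₂) renaming (_×_ to _⊗_)
open import Function using (_∘_; id)
open import Level using (Level; 0ℓ)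
open import Relation.Binary using (IsEquivalence)
open import Relation.Binary.PropositionalEquality as ≡ using (_≡_; _≢_)
open import Relation.Nullary using (¬_; Dec; yes; no; contradiction; ¬?; from-yes; _→-dec_)
open import Relation.Unary using (Pred; Decidable)
import Algebra.Properties.CommutativeSemigroup as CommutativeSemigroupProperties
import Algebra.Properties.CommutativeSemiring.Exp as CommutativeExp
import Algebra.Properties.Semiring.Exp as Exp
import Algebra.Properties.Semiring.Mult as Mult
import Algebra.Solver.Ring.NaturalCoefficients.Default as SemiringSolver
import Relation.Binary.Reasoning.Setoid as SetoidReasoning

-- The development adjoins variables in layers. Over the coefficients q is adjoined with q^K = 0,
-- and over that ring one more truncated variable: z, kept below degree 2N + 2, for the extraction
-- of z⁻¹; a dual number ε for E³, which is the derivative of the triple product at its zero z = -1.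
-- This is why the lemmas are stated over an arbitrary commutative semiring and instantiated at
-- several levels. Negative powers of z are never formed. A factor 1 + z⁻¹qⁱ becomes z + qⁱ, so all
-- indices are displaced: the exponents are d(d + 1)/2 with d the distance from a centre N + 1, and
-- the coefficient of z⁻¹ becomes that of degree 2N + 1. The number N + 1 of factors is free once it
-- is large; taking it equal to 5(n + 1) makes the displacement invisible modulo 5.

-- Displaced triangular numbers, the exponents of the triple product.

module Exponent where
  open import Data.Nat using (_+_; _*_; _≤_; _<_)
  open import Data.Nat.Properties
  open ≡ using (refl; cong; sym; trans; module ≡-Reasoning)

  triangle : ℕ → ℕ
  triangle zero    = 0
  triangle (suc n) = suc n + triangle n

  -- (i − N)(i − N + 1)/2
  shifted : ℕ → ℕ → ℕ
  shifted zero    i       = triangle i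
  shifted (suc N) zero    = triangle N
  shifted (suc N) (suc i) = shifted N i

  -- With d = i - N and T(d) = d(d + 1)/2 this is T(d + 1) = T(d) + d + 1; the term -N is moved to
  -- the left to stay in ℕ.
  shifted-suc : ∀ N i → shifted N (suc i) + N ≡ shifted N i + suc i
  shifted-suc zero          i       = trans (+-identityʳ _) (+-comm (suc i) (triangle i))
  shifted-suc (suc zero)    zero    = refl
  shifted-suc (suc (suc N)) zero    = lemma N (triangle N)
    where
    lemma : ∀ n t → t + suc (suc n) ≡ suc n + t + 1
    lemma = solve-∀
  shifted-suc (suc N)       (suc i) = begin
    shifted N (suc i) + suc N    ≡⟨ +-suc _ N ⟩
    suc (shifted N (suc i) + N)  ≡⟨ cong suc (shifted-suc N i) ⟩
    suc (shifted N i + suc i)    ≡⟨ +-suc _ (suc i) ⟨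
    shifted N i + suc (suc i)    ∎
    where open ≡-Reasoning

  shifted-sucˡ : ∀ N i → N + shifted N i ≡ shifted (suc N) i + i
  shifted-sucˡ zero    zero    = refl
  shifted-sucˡ (suc N) zero    = sym (+-identityʳ _)
  shifted-sucˡ N       (suc i) = trans (+-comm N _) (shifted-suc N i)

  -- Exponent bookkeeping for the factor 1 + z q^(M+1): the term of index i moves to index i + 1,
  -- and the surplus q^j is the weight that the Pascal rule attaches to it.
  shifted-predʳ : ∀ M N i j → i + j ≡ M + N → suc M + shifted N i ≡ shifted N (suc i) + j
  shifted-predʳ M N i j eq = +-cancelʳ-≡ N _ _ (begin
    suc M + shifted N i + N      ≡⟨ shuffle₁ M N (shifted N i) ⟩
    (M + N) + suc (shifted N i)  ≡⟨ cong (_+ suc (shifted N i)) eq ⟨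
    (i + j) + suc (shifted N i)  ≡⟨ shuffle₂ i j (shifted N i) ⟩
    (shifted N i + suc i) + j    ≡⟨ cong (_+ j) (shifted-suc N i) ⟨
    (shifted N (suc i) + N) + j  ≡⟨ shuffle₃ (shifted N (suc i)) N j ⟩
    shifted N (suc i) + j + N    ∎)
    where
    open ≡-Reasoning
    shuffle₁ : ∀ M N s → suc M + s + N ≡ (M + N) + suc s
    shuffle₁ = solve-∀
    shuffle₂ : ∀ i j s → (i + j) + suc s ≡ (s + suc i) + j
    shuffle₂ = solve-∀
    shuffle₃ : ∀ s N j → (s + N) + j ≡ s + j + N
    shuffle₃ = solve-∀

  private
    n≤triangle : ∀ n → n ≤ triangle n
    n≤triangle zero    = z≤n
    n≤triangle (suc n) = m≤m+n (suc n) _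

  shifted-lowerˡ : ∀ N i → N ≤ shifted N i + suc i
  shifted-lowerˡ zero    i       = z≤n
  shifted-lowerˡ (suc N) zero    = ≤-trans (s≤s (n≤triangle N)) (≤-reflexive (+-comm 1 (triangle N)))
  shifted-lowerˡ (suc N) (suc i) =
    ≤-trans (s≤s (shifted-lowerˡ N i)) (≤-reflexive (sym (+-suc _ (suc i))))

  shifted-lowerʳ : ∀ N i → i ≤ shifted N i + N
  shifted-lowerʳ zero    i       = ≤-trans (n≤triangle i) (m≤m+n _ 0)
  shifted-lowerʳ (suc N) zero    = z≤n
  shifted-lowerʳ (suc N) (suc i) =
    ≤-trans (s≤s (shifted-lowerʳ N i)) (≤-reflexive (sym (+-suc _ N)))

  shifted-double : ∀ N i → 2 * shifted N i + (2 * (N * i) + N) ≡ N * N + (i * i + i)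
  shifted-double zero zero = refl
  shifted-double zero (suc i) = begin
    2 * (suc i + triangle i) + 0         ≡⟨ lemma i (triangle i) ⟩
    (2 * triangle i + 0) + (2 * i + 2)   ≡⟨ cong (_+ (2 * i + 2)) (shifted-double zero i) ⟩
    i * i + i + (2 * i + 2)              ≡⟨ lemma₂ i ⟩
    suc i * suc i + suc i                ∎
    where
    open ≡-Reasoning
    lemma₂ : ∀ i → i * i + i + (2 * i + 2) ≡ suc i * suc i + suc i
    lemma₂ = solve-∀
    lemma : ∀ i t → 2 * (suc i + t) + 0 ≡ (2 * t + 0) + (2 * i + 2)
    lemma = solve-∀
  shifted-double (suc zero) zero = refl
  shifted-double (suc (suc N)) zero = begin
    2 * (suc N + t) + (2 * (suc (suc N) * 0) + suc (suc N)) ≡⟨ lemma N t ⟩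
    2 * t + (2 * (suc N * 0) + suc N) + (2 * N + 3)  ≡⟨ cong (_+ (2 * N + 3)) (shifted-double (suc N) zero) ⟩
    suc N * suc N + 0 + (2 * N + 3) ≡⟨ lemma₂ N ⟩
    suc (suc N) * suc (suc N) + 0 ∎
    where
    open ≡-Reasoning
    t = triangle N
    lemma : ∀ N t → 2 * (suc N + t) + (2 * (suc (suc N) * 0) + suc (suc N)) ≡ 2 * t + (2 * (suc N * 0) + suc N) + (2 * N + 3)
    lemma = solve-∀
    lemma₂ : ∀ N → suc N * suc N + 0 + (2 * N + 3) ≡ suc (suc N) * suc (suc N) + 0
    lemma₂ = solve-∀
  shifted-double (suc N) (suc i) = begin
    2 * t + (2 * (suc N * suc i) + suc N)        ≡⟨ lemma N i t ⟩
    2 * t + (2 * (N * i) + N) + (2 * N + 2 * i + 3)  ≡⟨ cong (_+ (2 * N + 2 * i + 3)) (shifted-double N i) ⟩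
    N * N + (i * i + i) + (2 * N + 2 * i + 3)    ≡⟨ lemma₂ N i ⟩
    suc N * suc N + (suc i * suc i + suc i)      ∎
    where
    open ≡-Reasoning
    t = shifted N i
    lemma : ∀ N i t → 2 * t + (2 * (suc N * suc i) + suc N) ≡ 2 * t + (2 * (N * i) + N) + (2 * N + 2 * i + 3)
    lemma = solve-∀
    lemma₂ : ∀ N i → N * N + (i * i + i) + (2 * N + 2 * i + 3) ≡ suc N * suc N + (suc i * suc i + suc i)
    lemma₂ = solve-∀

  -- Here d = i - N is below -K, so d(d + 1)/2 ≥ -d - 1 ≥ K. The mirror statement uses d(d + 1)/2 ≥
  -- d. Both serve to make q to this power vanish near the ends of the sum.
  shifted-largeˡ : ∀ {K} N i → K + K ≤ N → i < K → K ≤ shifted N i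
  shifted-largeˡ {K} N i 2K≤N i<K = +-cancelʳ-≤ K _ _ (begin
    K + K                  ≤⟨ 2K≤N ⟩
    N                      ≤⟨ shifted-lowerˡ N i ⟩
    shifted N i + suc i    ≤⟨ +-monoʳ-≤ (shifted N i) i<K ⟩
    shifted N i + K        ∎)
    where open ≤-Reasoning

  shifted-largeʳ : ∀ {K} N i j → K + K ≤ N → i + j ≡ N + N → j < K → K ≤ shifted N i
  shifted-largeʳ {K} N i j 2K≤N eq j<K = +-cancelʳ-≤ (K + N) _ _ (begin
    K + (K + N)              ≡⟨ +-assoc K K N ⟨
    (K + K) + N              ≤⟨ +-monoˡ-≤ N 2K≤N ⟩
    N + N                    ≡⟨ eq ⟨
    i + j                    ≤⟨ +-mono-≤ (shifted-lowerʳ N i) (<⇒≤ j<K) ⟩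
    (shifted N i + N) + K    ≡⟨ +-assoc (shifted N i) N K ⟩
    shifted N i + (N + K)    ≡⟨ cong (shifted N i +_) (+-comm N K) ⟩
    shifted N i + (K + N)    ∎)
    where open ≤-Reasoning

-- The quadratic obstruction modulo 5.

module Residue where
  open import Data.Nat using (_+_; _*_)
  open import Data.Nat.Properties
  open ≡ using (refl; cong; cong₂; sym; trans; subst; module ≡-Reasoning)
  open Exponent

  private
    pronic : ℕ → ℕ
    pronic n = n * n + n

    -- Since b ≡ -1 - a, the first two pronic numbers agree. Four times the sum, plus 3, is then
    -- 2(2a + 1)² + (2c + 1)² modulo 5; the value 3 would make this zero and force c = 2, which the
    -- second hypothesis excludes.
    table : (a b c : Fin 5) → (toℕ a + toℕ b + 1) % 5 ≡ 0 → (3 + toℕ c) % 5 ≢ 0 →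
            (pronic (toℕ a) + pronic (toℕ b) + pronic (toℕ c)) % 5 ≢ 3
    table = from-yes (all? {n = 5} λ a → all? {n = 5} λ b → all? {n = 5} λ c →
      ((toℕ a + toℕ b + 1) % 5 ≟ 0) →-dec (¬? ((3 + toℕ c) % 5 ≟ 0) →-dec
      ¬? ((pronic (toℕ a) + pronic (toℕ b) + pronic (toℕ c)) % 5 ≟ 3)))

    record Residue (n : ℕ) : Set where
      constructor residue
      field
        digit    : Fin 5
        quotient : ℕ
        split    : n ≡ toℕ digit + quotient * 5

    toResidue : ∀ n → Residue n
    toResidue n = residue (fromℕ< (m%n<n n 5)) (n / 5)
      (trans (m≡m%n+[m/n]*n n 5) (cong (_+ n / 5 * 5) (sym (toℕ-fromℕ< (m%n<n n 5)))))

  -- As 5 ∣ suc N, shifted (suc N) j is congruent to j(j + 1)/2;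
  -- k + l ≡ −1 makes the first two summands congruent.
  exponent-residue : ∀ K N k l i → suc N ≡ K * 5 → k + l ≡ N + suc N → (3 + i) % 5 ≢ 0 →
                     (shifted (suc N) k + shifted (suc N) l + shifted (suc N) i) % 5 ≢ 4
  exponent-residue K N k l i N≡5K k+l i≢ S%5≡4
    with residue a a′ refl ← toResidue k | residue b b′ refl ← toResidue l | residue c c′ refl ← toResidue i =
    table a b c sum-condition
      (λ eq → i≢ (trans ([m+kn]%n≡m%n (3 + toℕ c) c′ 5) eq)) pronic-condition
    where
    t : ℕ → ℕ
    t = shifted (suc N)

    S = t k + t l + t i
    r = toℕ a
    s = toℕ b
    u = toℕ c

    sum-condition : (r + s + 1) % 5 ≡ 0
    sum-condition = begin
      (r + s + 1) % 5                     ≡⟨ [m+kn]%n≡m%n (r + s + 1) (a′ + b′) 5 ⟨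
      (r + s + 1 + (a′ + b′) * 5) % 5     ≡⟨ cong (_% 5) (shuffle r s a′ b′) ⟩
      suc (k + l) % 5                     ≡⟨ cong (λ x → suc x % 5) k+l ⟩
      (suc N + suc N) % 5                 ≡⟨ cong (λ x → (x + x) % 5) N≡5K ⟩
      (K * 5 + K * 5) % 5                 ≡⟨ cong (_% 5) (sym (*-distribʳ-+ 5 K K)) ⟩
      (0 + (K + K) * 5) % 5               ≡⟨ [m+kn]%n≡m%n 0 (K + K) 5 ⟩
      0                                   ∎
      where
      open ≡-Reasoning
      shuffle : ∀ r s a b → r + s + 1 + (a + b) * 5 ≡ suc (r + a * 5 + (s + b * 5))
      shuffle = solve-∀

    double : ∀ j → 2 * t j + (2 * (K * 5 * j) + K * 5) ≡ K * 5 * (K * 5) + pronic j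
    double j = subst (λ M → 2 * t j + (2 * (M * j) + M) ≡ M * M + pronic j) N≡5K (shifted-double (suc N) j)

    -- Halves are avoided by doubling: S ≡ 4 becomes 2S ≡ 3, and in twice each exponent every term
    -- involving the centre `K * 5` drops out.
    pronic-condition : (pronic r + pronic s + pronic u) % 5 ≡ 3
    pronic-condition = begin
      (pronic r + pronic s + pronic u) % 5
        ≡⟨ [m+kn]%n≡m%n (pronic r + pronic s + pronic u) Y 5 ⟨
      (pronic r + pronic s + pronic u + Y * 5) % 5
        ≡⟨ cong (_% 5) (expand K r a′ s b′ u c′) ⟩
      ((K * 5 * (K * 5) + pronic k) + (K * 5 * (K * 5) + pronic l) + (K * 5 * (K * 5) + pronic i)) % 5
        ≡⟨ cong (_% 5) (cong₂ _+_ (cong₂ _+_ (double k) (double l)) (double i)) ⟨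
      ((2 * t k + (2 * (K * 5 * k) + K * 5)) + (2 * t l + (2 * (K * 5 * l) + K * 5)) +
       (2 * t i + (2 * (K * 5 * i) + K * 5))) % 5
        ≡⟨ cong (_% 5) (collect K (t k) (t l) (t i) k l i) ⟩
      (2 * S + X * 5) % 5
        ≡⟨ [m+kn]%n≡m%n (2 * S) X 5 ⟩
      (2 * S) % 5
        ≡⟨ cong (λ n → (2 * n) % 5) (trans (m≡m%n+[m/n]*n S 5) (cong (_+ S / 5 * 5) S%5≡4)) ⟩
      (2 * (4 + S / 5 * 5)) % 5
        ≡⟨ cong (_% 5) (twice (S / 5)) ⟩
      (8 + 2 * (S / 5) * 5) % 5
        ≡⟨ [m+kn]%n≡m%n 8 (2 * (S / 5)) 5 ⟩
      3 ∎
      where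
      open ≡-Reasoning
      X = 2 * (K * k) + K + (2 * (K * l) + K) + (2 * (K * i) + K)
      Y = 3 * (K * (K * 5)) + (2 * r * a′ + a′ * a′ * 5 + a′) + (2 * s * b′ + b′ * b′ * 5 + b′) +
          (2 * u * c′ + c′ * c′ * 5 + c′)
      collect : ∀ K x y z k l i →
        (2 * x + (2 * (K * 5 * k) + K * 5)) + (2 * y + (2 * (K * 5 * l) + K * 5)) +
        (2 * z + (2 * (K * 5 * i) + K * 5)) ≡
        2 * (x + y + z) + (2 * (K * k) + K + (2 * (K * l) + K) + (2 * (K * i) + K)) * 5
      collect = solve-∀
      expand : ∀ K r a s b u c →
        (r * r + r) + (s * s + s) + (u * u + u) +
        (3 * (K * (K * 5)) + (2 * r * a + a * a * 5 + a) + (2 * s * b + b * b * 5 + b) +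
         (2 * u * c + c * c * 5 + c)) * 5 ≡
        (K * 5 * (K * 5) + ((r + a * 5) * (r + a * 5) + (r + a * 5))) +
        (K * 5 * (K * 5) + ((s + b * 5) * (s + b * 5) + (s + b * 5))) +
        (K * 5 * (K * 5) + ((u + c * 5) * (u + c * 5) + (u + c * 5)))
      expand = solve-∀
      twice : ∀ n → 2 * (4 + n * 5) ≡ 8 + 2 * n * 5
      twice = solve-∀

-- Sums over antidiagonals and truncated power series.

module AntidiagonalSum {c ℓ} (R : CommutativeSemiring c ℓ) where
  open CommutativeSemiring R hiding (zero)
  open CommutativeSemigroupProperties +-commutativeSemigroup using (interchange)
  open SetoidReasoning setoid

  -- ∑ n F = Σ_{i+j=n} F i j
  ∑ : ℕ → (ℕ → ℕ → Carrier) → Carrier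
  ∑ zero    F = F 0 0
  ∑ (suc n) F = F 0 (suc n) + ∑ n (λ i j → F (suc i) j)

  ∑-cong : ∀ n {F G} → (∀ i j → i ℕ.+ j ≡ n → F i j ≈ G i j) → ∑ n F ≈ ∑ n G
  ∑-cong zero    F≈G = F≈G 0 0 ≡.refl
  ∑-cong (suc n) F≈G =
    +-cong (F≈G 0 (suc n) ≡.refl) (∑-cong n λ i j eq → F≈G (suc i) j (≡.cong suc eq))

  ∑-+ : ∀ n {F G} → ∑ n (λ i j → F i j + G i j) ≈ ∑ n F + ∑ n G
  ∑-+ zero    = refl
  ∑-+ (suc n) = trans (+-congˡ (∑-+ n)) (interchange _ _ _ _)

  ∑-*ˡ : ∀ n {F} x → x * ∑ n F ≈ ∑ n (λ i j → x * F i j)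
  ∑-*ˡ zero    x = refl
  ∑-*ˡ (suc n) x = trans (distribˡ x _ _) (+-congˡ (∑-*ˡ n x))

  ∑-*ʳ : ∀ n {F} x → ∑ n F * x ≈ ∑ n (λ i j → F i j * x)
  ∑-*ʳ zero    x = refl
  ∑-*ʳ (suc n) x = trans (distribʳ x _ _) (+-congˡ (∑-*ʳ n x))

  ∑-zero : ∀ n {F} → (∀ i j → i ℕ.+ j ≡ n → F i j ≈ 0#) → ∑ n F ≈ 0#
  ∑-zero zero    F≈0 = F≈0 0 0 ≡.refl
  ∑-zero (suc n) F≈0 =
    trans (+-cong (F≈0 0 (suc n) ≡.refl) (∑-zero n λ i j eq → F≈0 (suc i) j (≡.cong suc eq)))
          (+-identityˡ 0#)

  ∑-last : ∀ n {F} → ∑ (suc n) F ≈ ∑ n (λ i j → F i (suc j)) + F (suc n) 0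
  ∑-last zero        = refl
  ∑-last (suc n) {F} = trans (+-congˡ (∑-last n {λ i j → F (suc i) j})) (sym (+-assoc _ _ _))

  ∑-flip : ∀ n {F} → ∑ n F ≈ ∑ n (λ i j → F j i)
  ∑-flip zero        = refl
  ∑-flip (suc n) {F} = begin
    F 0 (suc n) + ∑ n (λ i j → F (suc i) j)  ≈⟨ +-congˡ (∑-flip n {λ i j → F (suc i) j}) ⟩
    F 0 (suc n) + ∑ n (λ i j → F (suc j) i)  ≈⟨ +-comm _ _ ⟩
    ∑ n (λ i j → F (suc j) i) + F 0 (suc n)  ≈⟨ ∑-last n {λ i j → F j i} ⟨
    ∑ (suc n) (λ i j → F j i)                ∎

  ∑-assoc : ∀ n {F : ℕ → ℕ → ℕ → Carrier} →
            ∑ n (λ i l → ∑ i (λ j k → F j k l)) ≈ ∑ n (λ j i → ∑ i (λ k l → F j k l))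
  ∑-assoc zero        = refl
  ∑-assoc (suc n) {F} = begin
    F 0 0 (suc n) + ∑ n (λ i l → F 0 (suc i) l + ∑ i (λ j k → F (suc j) k l))
      ≈⟨ +-congˡ (∑-+ n) ⟩
    F 0 0 (suc n) + (∑ n (λ i l → F 0 (suc i) l) + ∑ n (λ i l → ∑ i (λ j k → F (suc j) k l)))
      ≈⟨ +-assoc _ _ _ ⟨
    ∑ (suc n) (F 0) + ∑ n (λ i l → ∑ i (λ j k → F (suc j) k l))
      ≈⟨ +-congˡ (∑-assoc n) ⟩
    ∑ (suc n) (F 0) + ∑ n (λ j i → ∑ i (λ k l → F (suc j) k l))
      ∎

  -- The pattern behind multiplication by a binomial: interior terms receive one contribution from
  -- each summand, the two end terms only one. All product expansions below go through it.
  ∑-split : ∀ n {F G H} → F 0 (suc n) ≈ G 0 n → F (suc n) 0 ≈ H n 0 →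
            (∀ i j → suc (i ℕ.+ j) ≡ n → F (suc i) (suc j) ≈ G (suc i) j + H i (suc j)) →
            ∑ (suc n) F ≈ ∑ n G + ∑ n H
  ∑-split zero            first last middle = +-cong first last
  ∑-split (suc n) {F} {G} {H} first last middle = begin
    F 0 (2 ℕ.+ n) + ∑ (suc n) (λ i j → F (suc i) j)
      ≈⟨ +-cong first (∑-last n {λ i j → F (suc i) j}) ⟩
    G 0 (suc n) + (∑ n (λ i j → F (suc i) (suc j)) + F (2 ℕ.+ n) 0)
      ≈⟨ +-congˡ (+-cong (∑-cong n λ i j eq → middle i j (≡.cong suc eq)) last) ⟩
    G 0 (suc n) + (∑ n (λ i j → G (suc i) j + H i (suc j)) + H (suc n) 0)
      ≈⟨ +-congˡ (+-congʳ (∑-+ n)) ⟩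
    G 0 (suc n) + (∑ n (λ i j → G (suc i) j) + ∑ n (λ i j → H i (suc j)) + H (suc n) 0)
      ≈⟨ +-congˡ (+-assoc _ _ _) ⟩
    G 0 (suc n) + (∑ n (λ i j → G (suc i) j) + (∑ n (λ i j → H i (suc j)) + H (suc n) 0))
      ≈⟨ +-assoc _ _ _ ⟨
    ∑ (suc n) G + (∑ n (λ i j → H i (suc j)) + H (suc n) 0)
      ≈⟨ +-congˡ (∑-last n {H}) ⟨
    ∑ (suc n) G + ∑ (suc n) H ∎

-- R[X]/(X^K)
module PowerSeries {c ℓ} (R : CommutativeSemiring c ℓ) (K : ℕ) where
  private module R = CommutativeSemiring R
  open R using (_≈_; 0#; 1#)
  open AntidiagonalSum R

  -- Truncation lives in the equality alone: a series carries all its coefficients, and those from K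
  -- on are ignored.
  Series : Set c
  Series = ℕ → R.Carrier

  infix 4 _≋_

  -- A record rather than a function type, so that f and g can be inferred from f ≋ g.
  record _≋_ (f g : Series) : Set ℓ where
    constructor coeffwise
    field coeff : ∀ n → n ℕ.< K → f n ≈ g n
  open _≋_ public

  const : R.Carrier → Series
  const a zero    = a
  const a (suc n) = 0#

  X : Series
  X zero    = 0#
  X (suc n) = const 1# n

  infixl 6 _⊕_
  infixl 7 _⊛_

  _⊕_ : Series → Series → Series
  (f ⊕ g) n = f n R.+ g n

  _⊛_ : Series → Series → Series
  (f ⊛ g) n = ∑ n (λ i j → f i R.* g j)

  const-⊛-coeff : ∀ a f n → (const a ⊛ f) n ≈ a R.* f n
  const-⊛-coeff a f zero    = R.refl
  const-⊛-coeff a f (suc n) =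
    R.trans (R.+-congˡ (∑-zero n λ i j _ → R.zeroˡ _)) (R.+-identityʳ _)

  X-⊛-coeff-zero : ∀ f → (X ⊛ f) 0 ≈ 0#
  X-⊛-coeff-zero f = R.zeroˡ _

  X-⊛-coeff-suc : ∀ f n → (X ⊛ f) (suc n) ≈ f n
  X-⊛-coeff-suc f n =
    R.trans (R.+-cong (R.zeroˡ _) (R.trans (const-⊛-coeff 1# f n) (R.*-identityˡ _)))
            (R.+-identityˡ _)

  private
    ⊛-cong : ∀ {f f′ g g′} → f ≋ f′ → g ≋ g′ → (f ⊛ g) ≋ (f′ ⊛ g′)
    ⊛-cong f≋f′ g≋g′ = coeffwise λ n n<K → ∑-cong n λ { i j ≡.refl →
      R.*-cong (coeff f≋f′ i (ℕₚ.≤-<-trans (ℕₚ.m≤m+n i j) n<K))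
               (coeff g≋g′ j (ℕₚ.≤-<-trans (ℕₚ.m≤n+m j i) n<K)) }

    ⊛-comm : ∀ f g → (f ⊛ g) ≋ (g ⊛ f)
    ⊛-comm f g = coeffwise λ n _ → R.trans (∑-flip n) (∑-cong n λ i j _ → R.*-comm _ _)

    ⊛-assoc : ∀ f g h → ((f ⊛ g) ⊛ h) ≋ (f ⊛ (g ⊛ h))
    ⊛-assoc f g h = coeffwise λ n _ → begin
      ∑ n (λ i l → ∑ i (λ j k → f j R.* g k) R.* h l)
        ≈⟨ ∑-cong n (λ i l _ → ∑-*ʳ i (h l)) ⟩
      ∑ n (λ i l → ∑ i (λ j k → f j R.* g k R.* h l))
        ≈⟨ ∑-assoc n ⟩
      ∑ n (λ j i → ∑ i (λ k l → f j R.* g k R.* h l))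
        ≈⟨ ∑-cong n (λ j i _ →
             R.trans (∑-cong i λ k l _ → R.*-assoc _ _ _) (R.sym (∑-*ˡ i (f j)))) ⟩
      ∑ n (λ j i → f j R.* ∑ i (λ k l → g k R.* h l))
        ∎
      where open SetoidReasoning R.setoid

    ⊛-identityˡ : ∀ f → (const 1# ⊛ f) ≋ f
    ⊛-identityˡ f = coeffwise λ n _ → R.trans (const-⊛-coeff 1# f n) (R.*-identityˡ _)

    isEquivalence : IsEquivalence _≋_
    isEquivalence = record
      { refl  = coeffwise λ n _ → R.refl
      ; sym   = λ f≋g → coeffwise λ n n<K → R.sym (coeff f≋g n n<K)
      ; trans = λ f≋g g≋h → coeffwise λ n n<K → R.trans (coeff f≋g n n<K) (coeff g≋h n n<K)
      }

  commutativeSemiring : CommutativeSemiring c ℓ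
  commutativeSemiring = record
    { Carrier = Series
    ; _≈_ = _≋_
    ; _+_ = _⊕_
    ; _*_ = _⊛_
    ; 0# = λ _ → 0#
    ; 1# = const 1#
    ; isCommutativeSemiring = isCommutativeSemiringˡ record
      { +-isCommutativeMonoid = record
        { isMonoid = record
          { isSemigroup = record
            { isMagma = record
              { isEquivalence = isEquivalence
              ; ∙-cong = λ p q → coeffwise λ n n<K → R.+-cong (coeff p n n<K) (coeff q n n<K)
              }
            ; assoc = λ f g h → coeffwise λ n _ → R.+-assoc _ _ _
            }
          ; identity = (λ f → coeffwise λ n _ → R.+-identityˡ _) , (λ f → coeffwise λ n _ → R.+-identityʳ _)
          }
        ; comm = λ f g → coeffwise λ n _ → R.+-comm _ _
        }
      ; *-isCommutativeMonoid = record
        { isMonoid = record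
          { isSemigroup = record
            { isMagma = record { isEquivalence = isEquivalence ; ∙-cong = ⊛-cong }
            ; assoc = ⊛-assoc
            }
          ; identity = ⊛-identityˡ ,
                       (λ f → IsEquivalence.trans isEquivalence (⊛-comm f (const 1#)) (⊛-identityˡ f))
          }
        ; comm = ⊛-comm
        }
      ; distribʳ = λ h f g → coeffwise λ n _ → R.trans (∑-cong n λ i j _ → R.distribʳ _ _ _) (∑-+ n)
      ; zeroˡ = λ f → coeffwise λ n _ → ∑-zero n λ i j _ → R.zeroˡ _
      }
    }

  private module P = CommutativeSemiring commutativeSemiring
  open Exp R.semiring using (_^_)
  open Exp P.semiring using () renaming (_^_ to _^ᴾ_)
  module P∑ = AntidiagonalSum commutativeSemiring

  const-cong : ∀ {a b} → a ≈ b → const a ≋ const b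
  const-cong a≈b = coeffwise λ { zero _ → a≈b ; (suc n) _ → R.refl }

  const-0 : const 0# ≋ (λ _ → 0#)
  const-0 = coeffwise λ { zero _ → R.refl ; (suc n) _ → R.refl }

  const-+ : ∀ a b → const (a R.+ b) ≋ (const a ⊕ const b)
  const-+ a b = coeffwise λ { zero _ → R.refl ; (suc n) _ → R.sym (R.+-identityˡ _) }

  const-* : ∀ a b → const (a R.* b) ≋ (const a ⊛ const b)
  const-* a b = coeffwise λ
    { zero _    → R.refl
    ; (suc n) _ → R.sym (R.trans (const-⊛-coeff a (const b) (suc n)) (R.zeroʳ _)) }

  const-^ : ∀ a n → const (a ^ n) ≋ (const a ^ᴾ n)
  const-^ a zero    = P.refl
  const-^ a (suc n) = P.trans (const-* a (a ^ n)) (P.*-congˡ (const-^ a n))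

  ∑-coeff : ∀ n (F : ℕ → ℕ → Series) k → P∑.∑ n F k ≈ ∑ n (λ i j → F i j k)
  ∑-coeff zero    F k = R.refl
  ∑-coeff (suc n) F k = R.+-congˡ (∑-coeff n (λ i j → F (suc i) j) k)

  X^-coeff-≡ : ∀ e → (X ^ᴾ e) e ≈ 1#
  X^-coeff-≡ zero    = R.refl
  X^-coeff-≡ (suc e) = R.trans (X-⊛-coeff-suc (X ^ᴾ e) e) (X^-coeff-≡ e)

  X^-coeff-≢ : ∀ e n → e ≢ n → (X ^ᴾ e) n ≈ 0#
  X^-coeff-≢ zero    zero    e≢n = contradiction ≡.refl e≢n
  X^-coeff-≢ zero    (suc n) e≢n = R.refl
  X^-coeff-≢ (suc e) zero    e≢n = X-⊛-coeff-zero (X ^ᴾ e)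
  X^-coeff-≢ (suc e) (suc n) e≢n =
    R.trans (X-⊛-coeff-suc (X ^ᴾ e) n) (X^-coeff-≢ e n (e≢n ∘ ≡.cong suc))

  -- Induction on i: every summand but the first is divisible by X, and cancelling X lowers the
  -- index by one. The bound on i is there because the rearrangement is an equality of truncated
  -- series.
  polynomial-coeff : ∀ L (F : ℕ → ℕ → R.Carrier) i j → i ℕ.+ j ≡ L → i ℕ.< K →
                     P∑.∑ L (λ i j → const (F i j) ⊛ X ^ᴾ i) i ≈ F i j
  polynomial-coeff zero F zero zero _ _ = R.*-identityʳ _
  polynomial-coeff (suc L) F zero j ≡.refl _ = begin
    P∑.∑ (suc L) (λ i j → const (F i j) ⊛ X ^ᴾ i) 0
      ≈⟨ ∑-coeff (suc L) (λ i j → const (F i j) ⊛ X ^ᴾ i) 0 ⟩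
    F 0 (suc L) R.* 1# R.+ ∑ L (λ i j → F (suc i) j R.* (0# R.* (X ^ᴾ i) 0))
      ≈⟨ R.+-cong (R.*-identityʳ _)
           (∑-zero L λ i j _ → R.trans (R.*-congˡ (R.zeroˡ _)) (R.zeroʳ _)) ⟩
    F 0 (suc L) R.+ 0#
      ≈⟨ R.+-identityʳ _ ⟩
    F 0 (suc L) ∎
    where open SetoidReasoning R.setoid
  polynomial-coeff (suc L) F (suc i) j ≡.refl i<K = begin
    P∑.∑ (suc L) G (suc i)
      ≈⟨ R.+-cong (R.trans (const-⊛-coeff _ (const 1#) (suc i)) (R.zeroʳ _))
                  (coeff (P∑.∑-cong L {G = λ i j → X ⊛ (const (F (suc i) j) ⊛ X ^ᴾ i)}
                    (λ i j _ → x∙yz≈y∙xz (const (F (suc i) j)) X (X ^ᴾ i))) (suc i) i<K) ⟩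
    0# R.+ P∑.∑ L (λ i j → X ⊛ (const (F (suc i) j) ⊛ X ^ᴾ i)) (suc i)
      ≈⟨ R.+-identityˡ _ ⟩
    P∑.∑ L (λ i j → X ⊛ (const (F (suc i) j) ⊛ X ^ᴾ i)) (suc i)
      ≈⟨ coeff (P∑.∑-*ˡ L X) (suc i) i<K ⟨
    (X ⊛ P∑.∑ L (λ i j → const (F (suc i) j) ⊛ X ^ᴾ i)) (suc i)
      ≈⟨ X-⊛-coeff-suc (P∑.∑ L (λ i j → const (F (suc i) j) ⊛ X ^ᴾ i)) i ⟩
    P∑.∑ L (λ i j → const (F (suc i) j) ⊛ X ^ᴾ i) i
      ≈⟨ polynomial-coeff L (λ i → F (suc i)) i j ≡.refl (ℕₚ.<-trans (ℕₚ.n<1+n i) i<K) ⟩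
    F (suc i) j ∎
    where
    open SetoidReasoning R.setoid
    G = λ i j → const (F i j) ⊛ X ^ᴾ i
    open import Algebra.Properties.CommutativeSemigroup P.*-commutativeSemigroup using (x∙yz≈y∙xz)

-- Supports of truncated power series.

module Support {c ℓ} (R : CommutativeSemiring c ℓ) (K : ℕ) where
  private module R = CommutativeSemiring R
  open R using (_≈_; 0#)
  open AntidiagonalSum R
  open PowerSeries R K
  private module P = CommutativeSemiring commutativeSemiring
  open Exp P.semiring using (_^_)
  open Mult P.semiring using (_×_)

  -- An upper bound on the support. Congruences on exponents are tracked through it, so that no
  -- coefficient need be computed.
  Supported : ∀ {p} → Pred ℕ p → Series → Set _
  Supported S f = ∀ n → n ℕ.< K → ¬ S n → f n ≈ 0#

  module _ {p : Level} {S : Pred ℕ p} where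

    supported-≋ : ∀ {f g} → f ≋ g → Supported S f → Supported S g
    supported-≋ f≋g sf n n<K ¬s = R.trans (R.sym (coeff f≋g n n<K)) (sf n n<K ¬s)

    supported-0 : Supported S P.0#
    supported-0 n _ _ = R.refl

    supported-+ : ∀ {f g} → Supported S f → Supported S g → Supported S (f ⊕ g)
    supported-+ sf sg n n<K ¬s =
      R.trans (R.+-cong (sf n n<K ¬s) (sg n n<K ¬s)) (R.+-identityˡ 0#)

    supported-× : ∀ k {f} → Supported S f → Supported S (k × f)
    supported-× zero        sf = supported-0
    supported-× (suc k) {f} sf = supported-+ {f} {k × f} sf (supported-× k sf)

    supported-∑ : ∀ n F → (∀ i j → i ℕ.+ j ≡ n → Supported S (F i j)) → Supported S (P∑.∑ n F)
    supported-∑ n F sF k k<K ¬s =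
      R.trans (∑-coeff n F k) (∑-zero n λ i j eq → sF i j eq k k<K ¬s)

    -- If i + j lies outside U, then i is outside S or j is outside T; the decision procedure for S
    -- tells which factor vanishes.
    supported-* : ∀ {q r} {T : Pred ℕ q} {U : Pred ℕ r} {f g} → Decidable S →
                  (∀ {i j} → S i → T j → U (i ℕ.+ j)) →
                  Supported S f → Supported T g → Supported U (f ⊛ g)
    supported-* {T = T} {U} {f} {g} S? combine sf tg n n<K ¬u = ∑-zero n term
      where
      term : ∀ i j → i ℕ.+ j ≡ n → f i R.* g j ≈ 0#
      term i j ≡.refl with S? i
      ... | no ¬s = R.trans (R.*-congʳ (sf i (ℕₚ.≤-<-trans (ℕₚ.m≤m+n i j) n<K) ¬s)) (R.zeroˡ _)
      ... | yes s = R.trans (R.*-congˡ (tg j (ℕₚ.≤-<-trans (ℕₚ.m≤n+m j i) n<K)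
                      λ t → ¬u (combine s t))) (R.zeroʳ _)

    supported-⊆ : ∀ {q} {T : Pred ℕ q} {f} → (∀ {i} → S i → T i) → Supported S f → Supported T f
    supported-⊆ S⊆T sf n n<K ¬t = sf n n<K λ s → ¬t (S⊆T s)

  supported-const : ∀ a → Supported (_≡ 0) (const a)
  supported-const a zero    _ ¬s = contradiction ≡.refl ¬s
  supported-const a (suc n) _ ¬s = R.refl

  supported-X^ : ∀ e → Supported (_≡ e) (X ^ e)
  supported-X^ e n _ ¬s = X^-coeff-≢ e n λ e≡n → ¬s (≡.sym e≡n)

-- Gaussian binomials and the finite triple product.

module TripleProduct {c ℓ} (R : CommutativeSemiring c ℓ) where
  open Exponent
  open CommutativeSemiring R hiding (zero)
  open Exp semiring public
  open AntidiagonalSum R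
  open SetoidReasoning setoid
  open SemiringSolver R using (solve; con; _:+_; _:*_; _:=_)

  ∏ : ℕ → (ℕ → Carrier) → Carrier
  ∏ zero    f = 1#
  ∏ (suc n) f = ∏ n f * f n

  ∏-cong : ∀ n {f g} → (∀ i → f i ≈ g i) → ∏ n f ≈ ∏ n g
  ∏-cong zero    f≈g = refl
  ∏-cong (suc n) f≈g = *-cong (∏-cong n f≈g) (f≈g n)

  ∏-* : ∀ n {f g} → ∏ n (λ i → f i * g i) ≈ ∏ n f * ∏ n g
  ∏-* zero            = sym (*-identityˡ 1#)
  ∏-* (suc n) {f} {g} = trans (*-congʳ (∏-* n))
    (solve 4 (λ a b c d → (a :* b) :* (c :* d) := (a :* c) :* (b :* d)) refl
      (∏ n f) (∏ n g) (f n) (g n))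

  ∏-one : ∀ n {f} → (∀ i → f i ≈ 1#) → ∏ n f ≈ 1#
  ∏-one zero    f≈1 = refl
  ∏-one (suc n) f≈1 = trans (*-cong (∏-one n f≈1) (f≈1 n)) (*-identityˡ 1#)

  ∏-head : ∀ n {f} → ∏ (suc n) f ≈ f 0 * ∏ n (λ i → f (suc i))
  ∏-head zero        = *-comm _ _
  ∏-head (suc n) {f} = trans (*-congʳ (∏-head n)) (*-assoc _ _ _)

  ∏-const : ∀ n x → ∏ n (λ _ → x) ≈ x ^ n
  ∏-const zero    x = refl
  ∏-const (suc n) x = trans (*-comm _ x) (*-congˡ (∏-const n x))

  module _ (q : Carrier) where

    -- the q-binomial coefficient with upper index i + j and lower index i
    gauss : ℕ → ℕ → Carrier
    gauss zero    j       = 1#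
    gauss (suc i) zero    = 1#
    gauss (suc i) (suc j) = gauss (suc i) j + q ^ suc j * gauss i (suc j)

    -- The mirror image of the defining Pascal rule, with the weight on the other term. Each rule
    -- drives one half of the triple product: this one adds a factor z + q^N, the defining one a
    -- factor 1 + z q^(M+1).
    gauss-pascal : ∀ i j → gauss (suc i) (suc j) ≈ q ^ suc i * gauss (suc i) j + gauss i (suc j)
    gauss-pascal zero zero =
      +-comm _ _
    gauss-pascal zero (suc j) = begin
      gauss 1 (suc j) + q * (q * q ^ j) * 1#
        ≈⟨ +-congʳ (gauss-pascal zero j) ⟩
      (q * 1# * gauss 1 j + 1#) + q * (q * q ^ j) * 1#
        ≈⟨ solve 3 (λ q qʲ g → (q :* con 1 :* g :+ con 1) :+ q :* (q :* qʲ) :* con 1 :=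
                               q :* con 1 :* (g :+ q :* qʲ :* con 1) :+ con 1) refl
             q (q ^ j) (gauss 1 j) ⟩
      q * 1# * gauss 1 (suc j) + 1# ∎
    gauss-pascal (suc i) zero = begin
      1# + q * 1# * gauss (suc i) 1
        ≈⟨ +-congˡ (*-congˡ (gauss-pascal i zero)) ⟩
      1# + q * 1# * (q * q ^ i * 1# + gauss i 1)
        ≈⟨ solve 3 (λ q qⁱ g → con 1 :+ q :* con 1 :* (q :* qⁱ :* con 1 :+ g) :=
                               q :* (q :* qⁱ) :* con 1 :+ (con 1 :+ q :* con 1 :* g)) refl
             q (q ^ i) (gauss i 1) ⟩
      q ^ (2 ℕ.+ i) * 1# + gauss (suc i) 1 ∎
    gauss-pascal (suc i) (suc j) = begin
      gauss (2 ℕ.+ i) (suc j) + q ^ (2 ℕ.+ j) * gauss (suc i) (2 ℕ.+ j)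
        ≈⟨ +-cong (gauss-pascal (suc i) j) (*-congˡ (gauss-pascal i (suc j))) ⟩
      (q ^ (2 ℕ.+ i) * gauss (2 ℕ.+ i) j + gauss (suc i) (suc j)) +
      q ^ (2 ℕ.+ j) * (q ^ suc i * gauss (suc i) (suc j) + gauss i (2 ℕ.+ j))
        ≈⟨ solve 6 (λ q qⁱ qʲ x y z →
               (q :* (q :* qⁱ) :* x :+ y) :+ q :* (q :* qʲ) :* (q :* qⁱ :* y :+ z) :=
               q :* (q :* qⁱ) :* (x :+ q :* qʲ :* y) :+ (y :+ q :* (q :* qʲ) :* z)) refl
             q (q ^ i) (q ^ j) (gauss (2 ℕ.+ i) j) (gauss (suc i) (suc j)) (gauss i (2 ℕ.+ j)) ⟩
      q ^ (2 ℕ.+ i) * gauss (2 ℕ.+ i) (suc j) + gauss (suc i) (2 ℕ.+ j) ∎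

    module _ (z : Carrier) where

      private
        term : ℕ → ℕ → ℕ → Carrier
        term N i j = z ^ i * (q ^ shifted N i * gauss i j)

        exponents : ∀ a b c d → a ℕ.+ b ≡ c ℕ.+ d → q ^ a * q ^ b ≈ q ^ c * q ^ d
        exponents a b c d eq =
          trans (sym (^-homo-* q a b)) (trans (^-congʳ q eq) (^-homo-* q c d))

        -- The q-binomial theorem, which is the case of no upper factors and the start of the
        -- induction on M.
        lower-half : ∀ N → ∏ N (λ i → z + q ^ i) ≈ ∑ N (term N)
        lower-half zero    = solve 0 (con 1 := con 1 :* (con 1 :* con 1)) refl
        lower-half (suc N) = begin
          ∏ N (λ i → z + q ^ i) * (z + q ^ N)
            ≈⟨ *-congʳ (lower-half N) ⟩
          ∑ N (term N) * (z + q ^ N)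
            ≈⟨ solve 3 (λ s z u → s :* (z :+ u) := u :* s :+ z :* s) refl _ z (q ^ N) ⟩
          q ^ N * ∑ N (term N) + z * ∑ N (term N)
            ≈⟨ +-cong (∑-*ˡ N (q ^ N)) (∑-*ˡ N z) ⟩
          ∑ N (λ i j → q ^ N * term N i j) + ∑ N (λ i j → z * term N i j)
            ≈⟨ ∑-split N {term (suc N)} {λ i j → q ^ N * term N i j} {λ i j → z * term N i j}
                 (first N) (last N) (λ i j _ → middle i j) ⟨
          ∑ (suc N) (term (suc N)) ∎
          where
          raise : ∀ i → q ^ N * q ^ shifted N i ≈ q ^ shifted (suc N) i * q ^ i
          raise i = exponents N (shifted N i) (shifted (suc N) i) i (shifted-sucˡ N i)

          first : ∀ j → term (suc N) 0 (suc j) ≈ q ^ N * term N 0 j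
          first j = begin
            1# * (q ^ shifted (suc N) 0 * 1#)
              ≈⟨ solve 1 (λ u → con 1 :* (u :* con 1) := u :* con 1) refl _ ⟩
            q ^ shifted (suc N) 0 * 1#
              ≈⟨ raise 0 ⟨
            q ^ N * q ^ shifted N 0
              ≈⟨ solve 2 (λ v u → v :* u := v :* (con 1 :* (u :* con 1))) refl _ _ ⟩
            q ^ N * term N 0 j ∎

          last : ∀ i → term (suc N) (suc i) 0 ≈ z * term N i 0
          last zero    = *-assoc _ _ _
          last (suc i) = *-assoc _ _ _

          middle : ∀ i j → term (suc N) (suc i) (suc j) ≈
                           q ^ N * term N (suc i) j + z * term N i (suc j)
          middle i j = begin
            z ^ suc i * (q ^ shifted N i * gauss (suc i) (suc j))
              ≈⟨ *-congˡ (*-congˡ (gauss-pascal i j)) ⟩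
            z * z ^ i * (q ^ shifted N i * (q ^ suc i * gauss (suc i) j + gauss i (suc j)))
              ≈⟨ solve 6 (λ z zⁱ u v g h → z :* zⁱ :* (u :* (v :* g :+ h)) :=
                                           z :* zⁱ :* ((u :* v) :* g) :+ z :* (zⁱ :* (u :* h))) refl
                   z (z ^ i) (q ^ shifted N i) (q ^ suc i) (gauss (suc i) j) (gauss i (suc j)) ⟩
            z ^ suc i * ((q ^ shifted N i * q ^ suc i) * gauss (suc i) j) + z * term N i (suc j)
              ≈⟨ +-congʳ (*-congˡ (*-congʳ (raise (suc i)))) ⟨
            z ^ suc i * ((q ^ N * q ^ shifted N (suc i)) * gauss (suc i) j) + z * term N i (suc j)
              ≈⟨ +-congʳ (solve 4 (λ z u v g → z :* ((u :* v) :* g) := u :* (z :* (v :* g))) refl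
                   (z ^ suc i) _ _ _) ⟩
            q ^ N * term N (suc i) j + z * term N i (suc j) ∎

      -- Cauchy's finite form of the Jacobi triple product, multiplied by z^N so that 1 + z⁻¹qⁱ
      -- turns into z + qⁱ and z need not be invertible.
      finite-triple-product : ∀ M N →
        ∏ M (λ i → 1# + z * q ^ suc i) * ∏ N (λ i → z + q ^ i) ≈
        ∑ (M ℕ.+ N) (λ i j → z ^ i * (q ^ shifted N i * gauss i j))
      finite-triple-product zero    N = trans (*-identityˡ _) (lower-half N)
      finite-triple-product (suc M) N = begin
        ∏ M (λ i → 1# + z * q ^ suc i) * (1# + z * q ^ suc M) * ∏ N (λ i → z + q ^ i)
          ≈⟨ solve 3 (λ a b c → a :* b :* c := b :* (a :* c)) refl _ _ _ ⟩
        (1# + z * q ^ suc M) * (∏ M (λ i → 1# + z * q ^ suc i) * ∏ N (λ i → z + q ^ i))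
          ≈⟨ *-congˡ (finite-triple-product M N) ⟩
        (1# + z * q ^ suc M) * ∑ (M ℕ.+ N) (term N)
          ≈⟨ trans (distribʳ _ _ _) (+-cong (*-identityˡ _) (∑-*ˡ (M ℕ.+ N) _)) ⟩
        ∑ (M ℕ.+ N) (term N) + ∑ (M ℕ.+ N) (λ i j → z * q ^ suc M * term N i j)
          ≈⟨ ∑-split (M ℕ.+ N) {term N} {term N} {λ i j → z * q ^ suc M * term N i j}
               refl last middle ⟨
        ∑ (suc M ℕ.+ N) (term N) ∎
        where
        lower : ∀ i j → i ℕ.+ j ≡ M ℕ.+ N →
                q ^ suc M * q ^ shifted N i ≈ q ^ shifted N (suc i) * q ^ j
        lower i j eq = exponents (suc M) (shifted N i) (shifted N (suc i)) j (shifted-predʳ M N i j eq)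

        gauss-zeroʳ : ∀ i → gauss i 0 ≈ 1#
        gauss-zeroʳ zero    = refl
        gauss-zeroʳ (suc i) = refl

        last : term N (suc (M ℕ.+ N)) 0 ≈ z * q ^ suc M * term N (M ℕ.+ N) 0
        last = begin
          z * z ^ i * (q ^ shifted N (suc i) * 1#)
            ≈⟨ *-congˡ (lower i 0 (ℕₚ.+-identityʳ i)) ⟨
          z * z ^ i * (q ^ suc M * q ^ shifted N i)
            ≈⟨ solve 4 (λ z zⁱ u v → z :* zⁱ :* (u :* v) := z :* u :* (zⁱ :* (v :* con 1))) refl
                 _ _ _ _ ⟩
          z * q ^ suc M * (z ^ i * (q ^ shifted N i * 1#))
            ≈⟨ *-congˡ (*-congˡ (*-congˡ (gauss-zeroʳ i))) ⟨
          z * q ^ suc M * term N i 0 ∎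
          where i = M ℕ.+ N

        middle : ∀ i j → suc (i ℕ.+ j) ≡ M ℕ.+ N → term N (suc i) (suc j) ≈
                 term N (suc i) j + z * q ^ suc M * term N i (suc j)
        middle i j eq = begin
          z * z ^ i * (v * (gauss (suc i) j + q ^ suc j * gauss i (suc j)))
            ≈⟨ solve 6 (λ z zⁱ v w g h → z :* zⁱ :* (v :* (g :+ w :* h)) :=
                                         z :* zⁱ :* (v :* g) :+ z :* zⁱ :* ((v :* w) :* h)) refl
                 z (z ^ i) v (q ^ suc j) (gauss (suc i) j) (gauss i (suc j)) ⟩
          term N (suc i) j + z * z ^ i * ((v * q ^ suc j) * gauss i (suc j))
            ≈⟨ +-congˡ (*-congˡ (*-congʳ (lower i (suc j) (≡.trans (ℕₚ.+-suc i j) eq)))) ⟨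
          term N (suc i) j + z * z ^ i * ((q ^ suc M * q ^ shifted N i) * gauss i (suc j))
            ≈⟨ +-congˡ (solve 5 (λ z zⁱ u v h → z :* zⁱ :* ((u :* v) :* h) := z :* u :* (zⁱ :* (v :* h)))
                 refl _ _ _ _ _) ⟩
          term N (suc i) j + z * q ^ suc M * term N i (suc j) ∎
          where v = q ^ shifted N (suc i)

-- Euler products for nilpotent q and the limit of the triple product.

module Euler {c ℓ} (R : CommutativeSemiring c ℓ) where
  open Exponent
  open CommutativeSemiring R hiding (zero)
  open AntidiagonalSum R
  open TripleProduct R
  open SetoidReasoning setoid
  open SemiringSolver R using (solve; con; _:+_; _:*_; _:=_)

  ^-vanishes : ∀ x K → x ^ K ≈ 0# → ∀ {n} → K ℕ.≤ n → x ^ n ≈ 0#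
  ^-vanishes x K x^K≈0 {n} K≤n = begin
    x ^ n                    ≈⟨ ^-congʳ x (ℕₚ.m+[n∸m]≡n K≤n) ⟨
    x ^ (K ℕ.+ (n ℕ.∸ K))    ≈⟨ ^-homo-* x K (n ℕ.∸ K) ⟩
    x ^ K * x ^ (n ℕ.∸ K)    ≈⟨ *-congʳ x^K≈0 ⟩
    0# * x ^ (n ℕ.∸ K)       ≈⟨ zeroˡ _ ⟩
    0#                       ∎

  geometric : ℕ → Carrier → Carrier
  geometric zero    x = 0#
  geometric (suc n) x = geometric n x + x ^ n

  -- The argument m stands for -1, which lets ∏ (1 - qⁱ) be written without subtraction.
  euler : Carrier → Carrier → ℕ → Carrier
  euler m q n = ∏ n (λ i → 1# + m * q ^ suc i)

  module MinusOne (m : Carrier) (m+1≈0 : m + 1# ≈ 0#) where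

    complement : ∀ x → (1# + m * x) + x ≈ 1#
    complement x = begin
      (1# + m * x) + x      ≈⟨ solve 2 (λ m x → (con 1 :+ m :* x) :+ x := con 1 :+ (m :+ con 1) :* x) refl m x ⟩
      1# + (m + 1#) * x     ≈⟨ +-congˡ (trans (*-congʳ m+1≈0) (zeroˡ x)) ⟩
      1# + 0#               ≈⟨ +-identityʳ 1# ⟩
      1#                    ∎

    m²≈1 : m * m ≈ 1#
    m²≈1 = begin
      m * m                   ≈⟨ +-identityʳ _ ⟨
      m * m + 0#              ≈⟨ +-congˡ m+1≈0 ⟨
      m * m + (m + 1#)        ≈⟨ solve 1 (λ m → m :* m :+ (m :+ con 1) := m :* (m :+ con 1) :+ con 1) refl m ⟩
      m * (m + 1#) + 1#       ≈⟨ +-congʳ (trans (*-congˡ m+1≈0) (zeroʳ m)) ⟩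
      0# + 1#                 ≈⟨ +-identityˡ 1# ⟩
      1#                      ∎

    geometric-sum : ∀ n x → (1# + m * x) * geometric n x + x ^ n ≈ 1#
    geometric-sum zero    x = trans (+-congʳ (zeroʳ _)) (+-identityˡ 1#)
    geometric-sum (suc n) x = begin
      (1# + m * x) * (geometric n x + x ^ n) + x * x ^ n
        ≈⟨ solve 4 (λ p g xⁿ x → p :* (g :+ xⁿ) :+ x :* xⁿ := p :* g :+ (p :+ x) :* xⁿ) refl _ _ _ _ ⟩
      (1# + m * x) * geometric n x + ((1# + m * x) + x) * x ^ n
        ≈⟨ +-congˡ (trans (*-congʳ (complement x)) (*-identityˡ _)) ⟩
      (1# + m * x) * geometric n x + x ^ n
        ≈⟨ geometric-sum n x ⟩
      1# ∎

    geometric-inverse : ∀ n x → x ^ n ≈ 0# → (1# + m * x) * geometric n x ≈ 1#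
    geometric-inverse n x x^n≈0 = begin
      (1# + m * x) * geometric n x            ≈⟨ +-identityʳ _ ⟨
      (1# + m * x) * geometric n x + 0#       ≈⟨ +-congˡ x^n≈0 ⟨
      (1# + m * x) * geometric n x + x ^ n    ≈⟨ geometric-sum n x ⟩
      1#                                      ∎

    module Truncated (q : Carrier) (K : ℕ) (q^K≈0 : q ^ K ≈ 0#) where

      private
        E : ℕ → Carrier
        E = euler m q

      power-vanishes : ∀ e → (q ^ suc e) ^ K ≈ 0#
      power-vanishes e =
        trans (^-assocʳ q (suc e) K) (^-vanishes q K q^K≈0 (ℕₚ.m≤m+n K (e ℕ.* K)))

      euler-inverse : ∀ n → E n * ∏ n (λ i → geometric K (q ^ suc i)) ≈ 1#
      euler-inverse n = trans (sym (∏-* n))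
        (∏-one n λ i → geometric-inverse K (q ^ suc i) (power-vanishes i))

      euler-cancelˡ : ∀ n {x y} → E n * x ≈ E n * y → x ≈ y
      euler-cancelˡ n {x} {y} eq = begin
        x                    ≈⟨ unit x ⟨
        u * (E n * x)    ≈⟨ *-congˡ eq ⟩
        u * (E n * y)    ≈⟨ unit y ⟩
        y                    ∎
        where
        u = ∏ n (λ i → geometric K (q ^ suc i))
        unit : ∀ z → u * (E n * z) ≈ z
        unit z = begin
          u * (E n * z)    ≈⟨ solve 3 (λ u e z → u :* (e :* z) := (e :* u) :* z) refl _ _ _ ⟩
          (E n * u) * z    ≈⟨ *-congʳ (euler-inverse n) ⟩
          1# * z               ≈⟨ *-identityˡ z ⟩
          z                    ∎

      euler-stable : ∀ {n} → K ℕ.≤ n → E n ≈ E K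
      euler-stable {n} K≤n = trans (reflexive (≡.cong E (≡.sym (ℕₚ.m∸n+n≡m K≤n)))) (go (n ℕ.∸ K))
        where
        go : ∀ d → E (d ℕ.+ K) ≈ E K
        go zero    = refl
        go (suc d) = begin
          E (d ℕ.+ K) * (1# + m * q ^ suc (d ℕ.+ K))
            ≈⟨ *-cong (go d) (+-congˡ (*-congˡ
                 (^-vanishes q K q^K≈0 (ℕₚ.m≤n+m K (suc d))))) ⟩
          E K * (1# + m * 0#)
            ≈⟨ solve 2 (λ e m → e :* (con 1 :+ m :* con 0) := e) refl _ m ⟩
          E K ∎

      -- The quotient formula for Gaussian binomials, cleared of denominators. The induction rests
      -- on (1 - qʲ⁺¹) + qʲ⁺¹(1 - qⁱ⁺¹) = 1 - qⁱ⁺ʲ⁺².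
      gauss-euler : ∀ i j → gauss q i j * (E i * E j) ≈ E (i ℕ.+ j)
      gauss-euler zero    j       = trans (*-identityˡ _) (*-identityˡ _)
      gauss-euler (suc i) zero    = trans (*-identityˡ _) (trans (*-identityʳ _)
        (reflexive (≡.cong E (≡.sym (ℕₚ.+-identityʳ (suc i))))))
      gauss-euler (suc i) (suc j) = begin
        (gauss q (suc i) j + qʲ * gauss q i (suc j)) * (E i * pᵢ * (E j * pⱼ))
          ≈⟨ solve 7 (λ g u h a p b r →
                 (g :+ u :* h) :* (a :* p :* (b :* r)) :=
                 (g :* (a :* p :* b)) :* r :+ (h :* (a :* (b :* r))) :* (u :* p)) refl
               (gauss q (suc i) j) qʲ (gauss q i (suc j)) (E i) pᵢ (E j) pⱼ ⟩
        (gauss q (suc i) j * (E (suc i) * E j)) * pⱼ +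
        (gauss q i (suc j) * (E i * E (suc j))) * (qʲ * pᵢ)
          ≈⟨ +-cong (*-congʳ (gauss-euler (suc i) j)) (*-congʳ (gauss-euler i (suc j))) ⟩
        E (suc i ℕ.+ j) * pⱼ + E (i ℕ.+ suc j) * (qʲ * pᵢ)
          ≈⟨ +-congʳ (*-congʳ (reflexive (≡.cong E (≡.sym (ℕₚ.+-suc i j))))) ⟩
        E (i ℕ.+ suc j) * pⱼ + E (i ℕ.+ suc j) * (qʲ * pᵢ)
          ≈⟨ distribˡ _ _ _ ⟨
        E (i ℕ.+ suc j) * (pⱼ + qʲ * pᵢ)
          ≈⟨ *-congˡ factor ⟩
        E (suc i ℕ.+ suc j) ∎
        where
        qʲ = q ^ suc j
        qⁱ = q ^ suc i
        pᵢ = 1# + m * qⁱ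
        pⱼ = 1# + m * qʲ
        factor : pⱼ + qʲ * pᵢ ≈ 1# + m * q ^ suc (i ℕ.+ suc j)
        factor = begin
          (1# + m * qʲ) + qʲ * (1# + m * qⁱ)
            ≈⟨ solve 3 (λ m u v → (con 1 :+ m :* v) :+ v :* (con 1 :+ m :* u) :=
                                  ((con 1 :+ m :* v) :+ v) :+ m :* (u :* v)) refl m qⁱ qʲ ⟩
          ((1# + m * qʲ) + qʲ) + m * (qⁱ * qʲ)
            ≈⟨ +-cong (complement qʲ) (*-congˡ (sym (^-homo-* q (suc i) (suc j)))) ⟩
          1# + m * q ^ suc (i ℕ.+ suc j) ∎

      -- Once both indices reach K, all three Euler products in the quotient formula have
      -- stabilised; it reads gauss · E² = E, and the unit E cancels.
      gauss-limit : ∀ {i j} → K ℕ.≤ i → K ℕ.≤ j → E K * gauss q i j ≈ 1#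
      gauss-limit {i} {j} K≤i K≤j = euler-cancelˡ K (begin
        E K * (E K * gauss q i j)
          ≈⟨ solve 2 (λ e g → e :* (e :* g) := g :* (e :* e)) refl _ _ ⟩
        gauss q i j * (E K * E K)
          ≈⟨ *-congˡ (*-cong (euler-stable K≤i) (euler-stable K≤j)) ⟨
        gauss q i j * (E i * E j)
          ≈⟨ gauss-euler i j ⟩
        E (i ℕ.+ j)
          ≈⟨ euler-stable (ℕₚ.≤-trans K≤i (ℕₚ.m≤m+n i j)) ⟩
        E K
          ≈⟨ *-identityʳ _ ⟨
        E K * 1# ∎)

      module _ (N : ℕ) (2K≤N : K ℕ.+ K ℕ.≤ N) where

        private
          outside : ∀ {i j} → K ℕ.≤ shifted N i →
                    E K * (q ^ shifted N i * gauss q i j) ≈ q ^ shifted N i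
          outside {i} {j} K≤t = begin
            E K * (q ^ shifted N i * gauss q i j)
              ≈⟨ *-congˡ (*-congʳ (^-vanishes q K q^K≈0 K≤t)) ⟩
            E K * (0# * gauss q i j)
              ≈⟨ trans (*-congˡ (zeroˡ _)) (zeroʳ _) ⟩
            0#
              ≈⟨ ^-vanishes q K q^K≈0 K≤t ⟨
            q ^ shifted N i ∎

        -- The binomial has reached its limit only when both indices are at least K. In the
        -- remaining cases the power of q is already zero, so both sides vanish.
        gauss-term-limit : ∀ i j → i ℕ.+ j ≡ N ℕ.+ N →
                           E K * (q ^ shifted N i * gauss q i j) ≈ q ^ shifted N i
        gauss-term-limit i j eq with K ℕₚ.≤? i | K ℕₚ.≤? j
        ... | yes K≤i | yes K≤j = begin
          E K * (q ^ shifted N i * gauss q i j)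
            ≈⟨ solve 3 (λ e u g → e :* (u :* g) := u :* (e :* g)) refl _ _ _ ⟩
          q ^ shifted N i * (E K * gauss q i j)
            ≈⟨ *-congˡ (gauss-limit K≤i K≤j) ⟩
          q ^ shifted N i * 1#
            ≈⟨ *-identityʳ _ ⟩
          q ^ shifted N i ∎
        ... | no K≰i | _      = outside (shifted-largeˡ N i 2K≤N (ℕₚ.≰⇒> K≰i))
        ... | yes _  | no K≰j = outside (shifted-largeʳ N i j 2K≤N eq (ℕₚ.≰⇒> K≰j))

        triple-product : ∀ z →
          E K * (∏ N (λ i → 1# + z * q ^ suc i) * ∏ N (λ i → z + q ^ i)) ≈
          ∑ (N ℕ.+ N) (λ i j → z ^ i * q ^ shifted N i)
        triple-product z = begin
          E K * (∏ N (λ i → 1# + z * q ^ suc i) * ∏ N (λ i → z + q ^ i))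
            ≈⟨ *-congˡ (finite-triple-product q z N N) ⟩
          E K * ∑ (N ℕ.+ N) (λ i j → z ^ i * (q ^ shifted N i * gauss q i j))
            ≈⟨ ∑-*ˡ (N ℕ.+ N) (E K) ⟩
          ∑ (N ℕ.+ N) (λ i j → E K * (z ^ i * (q ^ shifted N i * gauss q i j)))
            ≈⟨ ∑-cong (N ℕ.+ N) (λ i j eq → trans
                 (solve 3 (λ e u v → e :* (u :* v) := u :* (e :* v)) refl _ _ _)
                 (*-congˡ (gauss-term-limit i j eq))) ⟩
          ∑ (N ℕ.+ N) (λ i j → z ^ i * q ^ shifted N i) ∎

module ConstantEuler {c ℓ} (R : CommutativeSemiring c ℓ) (K : ℕ) where
  open CommutativeSemiring R using (_≈_; _+_; 0#; 1#)
  open PowerSeries R K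
  private module P = CommutativeSemiring commutativeSemiring
  open TripleProduct R using (∏; _^_)
  open TripleProduct commutativeSemiring using () renaming (∏ to ∏ᴾ; _^_ to _^ᴾ_)
  open Euler R using (euler)
  open Euler commutativeSemiring using () renaming (euler to eulerᴾ)

  const-∏ : ∀ n {f F} → (∀ i → const (f i) ≋ F i) → const (∏ n f) ≋ ∏ᴾ n F
  const-∏ zero            f≋F = P.refl
  const-∏ (suc n) {f} {F} f≋F =
    P.trans (const-* (∏ n f) (f n)) (P.*-cong (const-∏ n f≋F) (f≋F n))

  const-euler : ∀ m q n → const (euler m q n) ≋ eulerᴾ (const m) (const q) n
  const-euler m q n = const-∏ n λ i →
    P.trans (const-+ 1# _) (P.+-congˡ (P.trans (const-* m _) (P.*-congˡ (const-^ q (suc i)))))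

  const-minus-one : ∀ m → m + 1# ≈ 0# → (const m ⊕ const 1#) ≋ P.0#
  const-minus-one m eq = P.trans (P.sym (const-+ m 1#)) (P.trans (const-cong eq) const-0)

  const-nilpotent : ∀ q k → q ^ k ≈ 0# → (const q ^ᴾ k) ≋ P.0#
  const-nilpotent q k eq = P.trans (P.sym (const-^ q k)) (P.trans (const-cong eq) const-0)

-- Jacobi's identity for the cube of the Euler product.

module Jacobi {c ℓ} (R : CommutativeSemiring c ℓ) where
  open Exponent
  open CommutativeSemiring R hiding (zero)
  open AntidiagonalSum R
  open TripleProduct R
  open Mult semiring using (_×_; ×-comm-*)
  open Euler R using (euler; module MinusOne)
  open SemiringSolver R using (solve; con; _:+_; _:*_; _:=_)

  -- R[ε]/(ε²), with ε = X
  private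
    open PowerSeries R 2
    open ConstantEuler R 2
    module D = CommutativeSemiring commutativeSemiring
    module D∏ = TripleProduct commutativeSemiring
    module D∑ = AntidiagonalSum commutativeSemiring
    open D∏ using () renaming (_^_ to _^ᴰ_; ∏ to ∏ᴰ)

    ∏-coeff₀ : ∀ n F → ∏ᴰ n F 0 ≈ ∏ n (λ i → F i 0)
    ∏-coeff₀ zero    F = refl
    ∏-coeff₀ (suc n) F = *-congʳ (∏-coeff₀ n F)

    const-^-coeff₀ : ∀ a n → (const a ^ᴰ n) 0 ≈ a ^ n
    const-^-coeff₀ a n = sym (coeff (const-^ a n) 0 (s≤s z≤n))

  module _ (m : Carrier) (m+1≈0 : m + 1# ≈ 0#) where
    open MinusOne m m+1≈0 using (m²≈1)
    private
      -- The point -1 + ε: the ε-coefficient of a polynomial in `z` is its derivative at -1.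
      z : Series
      z = const m ⊕ X

      z^n-coeff₀ : ∀ n → (z ^ᴰ n) 0 ≈ m ^ n
      z^n-coeff₀ zero    = refl
      z^n-coeff₀ (suc n) = *-cong (+-identityʳ m) (z^n-coeff₀ n)

      -- The derivative n mⁿ⁻¹, written as n mⁿ⁺¹ by means of m² = 1 so that no predecessor of n
      -- appears.
      z^n-coeff₁ : ∀ n → (z ^ᴰ n) 1 ≈ n × m ^ suc n
      z^n-coeff₁ zero    = refl
      z^n-coeff₁ (suc n) = begin
        (m + 0#) * (z ^ᴰ n) 1 + (0# + 1#) * (z ^ᴰ n) 0
          ≈⟨ +-cong (*-cong (+-identityʳ m) (z^n-coeff₁ n))
                    (*-cong (+-identityˡ 1#) (z^n-coeff₀ n)) ⟩
        m * (n × m ^ suc n) + 1# * m ^ n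
          ≈⟨ +-cong (×-comm-* n m (m ^ suc n)) (trans (*-congʳ (sym m²≈1)) (*-assoc m m _)) ⟩
        n × m ^ (2 ℕ.+ n) + m ^ (2 ℕ.+ n)
          ≈⟨ +-comm _ _ ⟩
        suc n × m ^ (2 ℕ.+ n) ∎
        where open SetoidReasoning setoid

      z+1≋X : (z ⊕ const 1#) ≋ X
      z+1≋X = coeffwise λ
        { zero _          → trans (+-congʳ (+-identityʳ m)) m+1≈0
        ; (suc zero) _    → trans (+-identityʳ _) (+-identityˡ 1#)
        ; (suc (suc _)) (s≤s (s≤s ())) }

    module _ (q : Carrier) (K : ℕ) (q^K≈0 : q ^ K ≈ 0#)
             (N : ℕ) (K≤N : K ℕ.≤ N) (2K≤1+N : K ℕ.+ K ℕ.≤ suc N) where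
      private
        E = euler m q
        open Euler.MinusOne.Truncated R m m+1≈0 q K q^K≈0 using (euler-stable)
        open Euler.MinusOne.Truncated commutativeSemiring
          (const m) (const-minus-one m m+1≈0) (const q) K (const-nilpotent q K q^K≈0)
          using (triple-product)
        E[ε] = Euler.euler commutativeSemiring (const m) (const q)

        upper lower : ℕ → Series
        upper i = const 1# ⊕ z ⊛ const q ^ᴰ suc i
        lower i = z ⊕ const q ^ᴰ i

        upper-coeff₀ : ∏ᴰ (suc N) upper 0 ≈ E (suc N)
        upper-coeff₀ = trans (∏-coeff₀ (suc N) upper) (∏-cong (suc N) λ i →
          +-congˡ (*-cong (+-identityʳ m) (const-^-coeff₀ q (suc i))))

        -- At z = -1 each remaining factor is -1 + qⁱ = -(1 - qⁱ), which leaves N signs in front of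
        -- the Euler product.
        lower-coeff₀ : ∏ᴰ N (λ i → lower (suc i)) 0 ≈ m ^ N * E N
        lower-coeff₀ = begin
          ∏ᴰ N (λ i → lower (suc i)) 0
            ≈⟨ ∏-coeff₀ N (λ i → lower (suc i)) ⟩
          ∏ N (λ i → (m + 0#) + (const q ^ᴰ suc i) 0)
            ≈⟨ ∏-cong N (λ i → trans (+-cong (+-identityʳ m) (const-^-coeff₀ q (suc i)))
                                     (factor (q ^ suc i))) ⟩
          ∏ N (λ i → m * (1# + m * q ^ suc i))
            ≈⟨ ∏-* N ⟩
          ∏ N (λ _ → m) * E N
            ≈⟨ *-congʳ (∏-const N m) ⟩
          m ^ N * E N ∎
          where
          open SetoidReasoning setoid
          factor : ∀ x → m + x ≈ m * (1# + m * x)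
          factor x = begin
            m + x                ≈⟨ +-congˡ (trans (*-congʳ m²≈1) (*-identityˡ x)) ⟨
            m + (m * m) * x      ≈⟨ solve 2 (λ m x → m :+ (m :* m) :* x := m :* (con 1 :+ m :* x)) refl m x ⟩
            m * (1# + m * x)     ∎

        -- The factor z + q⁰ equals ε, so the ε-coefficient of the product is its cofactor at z = −1.
        product-factor : ∀ c → (E[ε] K ⊛ (z ^ᴰ c ⊛ (∏ᴰ (suc N) upper ⊛ ∏ᴰ (suc N) lower))) ≋
          (X ⊛ (const (E K) ⊛ (z ^ᴰ c ⊛ (∏ᴰ (suc N) upper ⊛ ∏ᴰ N (λ i → lower (suc i))))))
        product-factor c = begin
          E[ε] K ⊛ (z ^ᴰ c ⊛ (U ⊛ ∏ᴰ (suc N) lower))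
            ≈⟨ D.*-cong (D.sym (const-euler m q K))
                 (D.*-congˡ (D.*-congˡ (D.trans (D∏.∏-head N) (D.*-congʳ z+1≋X)))) ⟩
          const (E K) ⊛ (z ^ᴰ c ⊛ (U ⊛ (X ⊛ L)))
            ≈⟨ solveᴰ 5 (λ e w u x l → e :*ᴰ (w :*ᴰ (u :*ᴰ (x :*ᴰ l))) :=ᴰ x :*ᴰ (e :*ᴰ (w :*ᴰ (u :*ᴰ l))))
                 D.refl (const (E K)) (z ^ᴰ c) U X L ⟩
          X ⊛ (const (E K) ⊛ (z ^ᴰ c ⊛ (U ⊛ L))) ∎
          where
          open SetoidReasoning D.setoid
          open SemiringSolver commutativeSemiring using ()
            renaming (solve to solveᴰ; _:*_ to _:*ᴰ_; _:=_ to _:=ᴰ_)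
          U = ∏ᴰ (suc N) upper
          L = ∏ᴰ N (λ i → lower (suc i))

        product-expansion : ∀ c → (E[ε] K ⊛ (z ^ᴰ c ⊛ (∏ᴰ (suc N) upper ⊛ ∏ᴰ (suc N) lower))) ≋
          D∑.∑ (suc N ℕ.+ suc N) (λ i j → const (q ^ shifted (suc N) i) ⊛ z ^ᴰ (c ℕ.+ i))
        product-expansion c = begin
          E[ε] K ⊛ (z ^ᴰ c ⊛ P)
            ≈⟨ x∙yz≈y∙xz (E[ε] K) (z ^ᴰ c) P ⟩
          z ^ᴰ c ⊛ (E[ε] K ⊛ P)
            ≈⟨ D.*-congˡ (triple-product (suc N) 2K≤1+N z) ⟩
          z ^ᴰ c ⊛ D∑.∑ (suc N ℕ.+ suc N) (λ i j → z ^ᴰ i ⊛ const q ^ᴰ shifted (suc N) i)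
            ≈⟨ D∑.∑-*ˡ (suc N ℕ.+ suc N) {λ i j → z ^ᴰ i ⊛ const q ^ᴰ shifted (suc N) i} (z ^ᴰ c) ⟩
          D∑.∑ (suc N ℕ.+ suc N) (λ i j → z ^ᴰ c ⊛ (z ^ᴰ i ⊛ const q ^ᴰ shifted (suc N) i))
            ≈⟨ D∑.∑-cong (suc N ℕ.+ suc N) (λ i j _ → D.trans
                 (D.sym (D.*-assoc (z ^ᴰ c) (z ^ᴰ i) (const q ^ᴰ shifted (suc N) i)))
                 (D.trans (D.*-comm (z ^ᴰ c ⊛ z ^ᴰ i) (const q ^ᴰ shifted (suc N) i))
                   (D.*-cong (D.sym (const-^ q (shifted (suc N) i)))
                             (D.sym (D∏.^-homo-* z c i))))) ⟩
          D∑.∑ (suc N ℕ.+ suc N) (λ i j → const (q ^ shifted (suc N) i) ⊛ z ^ᴰ (c ℕ.+ i)) ∎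
          where
          open SetoidReasoning D.setoid
          open import Algebra.Properties.CommutativeSemigroup D.*-commutativeSemigroup using (x∙yz≈y∙xz)
          P = ∏ᴰ (suc N) upper ⊛ ∏ᴰ (suc N) lower

      -- The shift by c is free since the alternating sum of the q^shifted vanishes.
      jacobi : ∀ c → m ^ (c ℕ.+ N) * (E K * (E K * E K)) ≈
               ∑ (suc N ℕ.+ suc N) (λ i j →
                 q ^ shifted (suc N) i * ((c ℕ.+ i) × m ^ suc (c ℕ.+ i)))
      jacobi c = begin
        m ^ (c ℕ.+ N) * (E K * (E K * E K))
          ≈⟨ *-congʳ (^-homo-* m c N) ⟩
        m ^ c * m ^ N * (E K * (E K * E K))
          ≈⟨ solve 3 (λ a b e → a :* b :* (e :* (e :* e)) := e :* (a :* (e :* (b :* e)))) refl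
               (m ^ c) (m ^ N) (E K) ⟩
        E K * (m ^ c * (E K * (m ^ N * E K)))
          -- The three copies of E: one is the prefactor of the triple product, one comes from the
          -- upper factors, one from the lower factors.
          ≈⟨ *-congˡ (*-cong (z^n-coeff₀ c) (*-cong
               (trans upper-coeff₀ (euler-stable (ℕₚ.m≤n⇒m≤1+n K≤N)))
               (trans lower-coeff₀ (*-congˡ (euler-stable K≤N))))) ⟨
        E K * ((z ^ᴰ c) 0 * (∏ᴰ (suc N) upper 0 * ∏ᴰ N (λ i → lower (suc i)) 0))
          ≈⟨ X-⊛-coeff-suc (const (E K) ⊛ (z ^ᴰ c ⊛ (∏ᴰ (suc N) upper ⊛ ∏ᴰ N (λ i → lower (suc i))))) 0 ⟨
        (X ⊛ (const (E K) ⊛ (z ^ᴰ c ⊛ (∏ᴰ (suc N) upper ⊛ ∏ᴰ N (λ i → lower (suc i)))))) 1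
          ≈⟨ coeff (D.trans (D.sym (product-factor c)) (product-expansion c)) 1 (s≤s (s≤s z≤n)) ⟩
        D∑.∑ (suc N ℕ.+ suc N) (λ i j → const (q ^ shifted (suc N) i) ⊛ z ^ᴰ (c ℕ.+ i)) 1
          ≈⟨ ∑-coeff (suc N ℕ.+ suc N) (λ i j → const (q ^ shifted (suc N) i) ⊛ z ^ᴰ (c ℕ.+ i)) 1 ⟩
        ∑ (suc N ℕ.+ suc N) (λ i j → (const (q ^ shifted (suc N) i) ⊛ z ^ᴰ (c ℕ.+ i)) 1)
          ≈⟨ ∑-cong (suc N ℕ.+ suc N) (λ i j _ → trans
               (const-⊛-coeff (q ^ shifted (suc N) i) (z ^ᴰ (c ℕ.+ i)) 1)
               (*-congˡ (z^n-coeff₁ (c ℕ.+ i)))) ⟩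
        ∑ (suc N ℕ.+ suc N) (λ i j → q ^ shifted (suc N) i * ((c ℕ.+ i) × m ^ suc (c ℕ.+ i))) ∎
        where open SetoidReasoning setoid

-- Generating functions of the rows.

module RowSeries {c ℓ} (R : CommutativeSemiring c ℓ) where
  open CommutativeSemiring R hiding (zero)
  open AntidiagonalSum R
  open TripleProduct R
  open Euler R using (^-vanishes)
  open SetoidReasoning setoid
  open SemiringSolver R using (solve; con; _:+_; _:*_; _:=_)

  -- Both sides expand to z² + zu + u². The left one has the form of triple product factors at xz
  -- and yz, the right one that of the factors of `rowSeries-product` with second variable 1, whence
  -- the trailing `1#`.
  omega-factors : ∀ x y → x + y ≈ 1# → x * y ≈ 1# → ∀ z u →
                  (x * z + u) * (y * z + u) ≈ (z + y * u * 1#) * (z + x * u * 1#)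
  omega-factors x y x+y≈1 xy≈1 z u = begin
    (x * z + u) * (y * z + u)
      ≈⟨ solve 4 (λ x y z u → (x :* z :+ u) :* (y :* z :+ u) :=
                              (x :* y) :* (z :* z) :+ ((x :+ y) :* (z :* u) :+ u :* u)) refl x y z u ⟩
    (x * y) * (z * z) + ((x + y) * (z * u) + u * u)
      ≈⟨ +-cong (trans (*-congʳ xy≈1) (*-identityˡ _))
                (+-congˡ (sym (trans (*-congʳ xy≈1) (*-identityˡ _)))) ⟩
    z * z + ((x + y) * (z * u) + (x * y) * (u * u))
      ≈⟨ solve 4 (λ x y z u → z :* z :+ ((x :+ y) :* (z :* u) :+ (x :* y) :* (u :* u)) :=
                              (z :+ y :* u :* con 1) :* (z :+ x :* u :* con 1)) refl x y z u ⟩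
    (z + y * u * 1#) * (z + x * u * 1#) ∎

  -- b₀, b₁ + v b₀, … : the coefficients of a power series multiplied by 1 + v z
  timesLinear : Carrier → (ℕ → Carrier) → ℕ → Carrier
  timesLinear v b zero    = b zero
  timesLinear v b (suc k) = b (suc k) + v * b k

  -- Homogeneous in w and z so as to serve both rows: the top row takes (1, X), the bottom row (X,
  -- 1), the latter being a polynomial in z⁻¹ cleared of denominators. The hypothesis on b bounds
  -- its degree.
  timesLinear-∑ : ∀ w z v b n → b (suc n) ≈ 0# →
    (w + v * z) * ∑ n (λ i j → w ^ i * (z ^ j * b j)) ≈
    ∑ (suc n) (λ i j → w ^ i * (z ^ j * timesLinear v b j))
  timesLinear-∑ w z v b n b≈0 = sym (begin
    ∑ (suc n) F
      ≈⟨ ∑-split n {F} {λ i j → v * z * T i j} {λ i j → w * T i j} first (*-assoc _ _ _) middle ⟩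
    ∑ n (λ i j → v * z * T i j) + ∑ n (λ i j → w * T i j)
      ≈⟨ +-cong (∑-*ˡ n (v * z)) (∑-*ˡ n w) ⟨
    v * z * ∑ n T + w * ∑ n T
      ≈⟨ solve 3 (λ u w s → u :* s :+ w :* s := (w :+ u) :* s) refl (v * z) w (∑ n T) ⟩
    (w + v * z) * ∑ n T ∎)
    where
    T F : ℕ → ℕ → Carrier
    T i j = w ^ i * (z ^ j * b j)
    F i j = w ^ i * (z ^ j * timesLinear v b j)
    first : F 0 (suc n) ≈ v * z * T 0 n
    first = begin
      1# * (z * z ^ n * (b (suc n) + v * b n))
        ≈⟨ *-congˡ (*-congˡ (trans (+-congʳ b≈0) (+-identityˡ _))) ⟩
      1# * (z * z ^ n * (v * b n))
        ≈⟨ solve 4 (λ z zⁿ v b → con 1 :* (z :* zⁿ :* (v :* b)) := v :* z :* (con 1 :* (zⁿ :* b)))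
             refl z (z ^ n) v (b n) ⟩
      v * z * T 0 n ∎
    middle : ∀ i j → suc (i ℕ.+ j) ≡ n → F (suc i) (suc j) ≈ v * z * T (suc i) j + w * T i (suc j)
    middle i j _ = solve 7 (λ w wⁱ z zʲ v b b′ →
        w :* wⁱ :* (z :* zʲ :* (b′ :+ v :* b)) :=
        v :* z :* (w :* wⁱ :* (zʲ :* b)) :+ w :* (wⁱ :* (z :* zʲ :* b′))) refl
      w (w ^ i) z (z ^ j) v (b j) (b (suc j))

  module _ (q : Carrier) where

    series : ∀ {a} {A : Set a} → (A → ℕ) → List A → Carrier
    series w []      = 0#
    series w (x ∷ l) = q ^ w x + series w l

    series-++ : ∀ {a} {A : Set a} (w : A → ℕ) l l′ →
                series w (l ++ l′) ≈ series w l + series w l′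
    series-++ w []      l′ = sym (+-identityˡ _)
    series-++ w (x ∷ l) l′ = trans (+-congˡ (series-++ w l l′)) (sym (+-assoc _ _ _))

    series-map : ∀ {a b} {A : Set a} {B : Set b} (w : A → ℕ) {w′ : B → ℕ} (f : B → A) e →
                 (∀ y → w (f y) ≡ e ℕ.+ w′ y) → ∀ l →
                 series w (map f l) ≈ q ^ e * series w′ l
    series-map w f e w∘f []      = sym (zeroʳ _)
    series-map w {w′} f e w∘f (y ∷ l) = begin
      q ^ w (f y) + series w (map f l)
        ≈⟨ +-cong (trans (^-congʳ q (w∘f y)) (^-homo-* q e (w′ y))) (series-map w f e w∘f l) ⟩
      q ^ e * q ^ w′ y + q ^ e * series w′ l
        ≈⟨ distribˡ _ _ _ ⟨
      q ^ e * series w′ (y ∷ l) ∎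

    series-pairs : ∀ {a b} {A : Set a} {B : Set b} (w : A ⊗ B → ℕ) (u : A → ℕ) (v : B → ℕ) →
                   (∀ x y → w (x , y) ≡ u x ℕ.+ v y) → ∀ l l′ →
                   series w (concatMap (λ x → map (x ,_) l′) l) ≈ series u l * series v l′
    series-pairs w u v w≡u+v []      l′ = sym (zeroˡ _)
    series-pairs w u v w≡u+v (x ∷ l) l′ = begin
      series w (map (x ,_) l′ ++ concatMap (λ x → map (x ,_) l′) l)
        ≈⟨ series-++ w (map (x ,_) l′) _ ⟩
      series w (map (x ,_) l′) + series w (concatMap (λ x → map (x ,_) l′) l)
        ≈⟨ +-cong (series-map w (x ,_) (u x) (w≡u+v x) l′) (series-pairs w u v w≡u+v l l′) ⟩
      q ^ u x * series v l′ + series u l * series v l′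
        ≈⟨ distribʳ _ _ _ ⟨
      series u (x ∷ l) * series v l′ ∎

    -- A general f lets the induction pass to `f ∘ suc`. The vanishing of G beyond n permits padding
    -- the sum to the longer range that the theta identity needs.
    series-applyUpTo : ∀ {a} {A : Set a} (w : A → ℕ) (F : ℕ → List A) f n M →
      n ℕ.≤ suc M → ∀ (G : ℕ → Carrier) → (∀ k → k ℕ.< n → series w (F (f k)) ≈ G k) →
      (∀ k → n ℕ.≤ k → G k ≈ 0#) →
      series w (concatMap F (applyUpTo f n)) ≈ ∑ M (λ k _ → G k)
    series-applyUpTo w F f zero    M _ G F≈G G≈0 = sym (∑-zero M λ k _ _ → G≈0 k z≤n)
    series-applyUpTo w F f (suc zero) zero _ G F≈G G≈0 =
      trans (series-++ w (F (f 0)) []) (trans (+-identityʳ _) (F≈G 0 (s≤s z≤n)))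
    series-applyUpTo w F f (suc (suc n)) zero (s≤s ()) G F≈G G≈0
    series-applyUpTo w F f (suc n) (suc M) (s≤s n≤M) G F≈G G≈0 =
      trans (series-++ w (F (f 0)) _) (+-cong (F≈G 0 (s≤s z≤n))
        (series-applyUpTo w F (f ∘ suc) n M n≤M (G ∘ suc)
          (λ k k<n → F≈G (suc k) (s≤s k<n)) (λ k n≤k → G≈0 (suc k) (s≤s n≤k))))

    -- The parameter s is what an entry adds to the weight besides its value: 1 in the top row,
    -- through the summand m₁, and 0 in the bottom row.
    module Rows (w : List ℕ → ℕ) (s : ℕ) (w-[] : w [] ≡ 0)
                (w-∷ : ∀ a r → w (a ∷ r) ≡ (s ℕ.+ a) ℕ.+ w r) where

      rowSeries : ℕ → ℕ → Carrier
      rowSeries V k = series w (rowsBelow V k)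

      rowSeries-zero : rowSeries 0 0 ≈ 1#
      rowSeries-zero = trans (+-identityʳ _) (^-congʳ q w-[])

      module _ (V : ℕ) where
        private
          u = q ^ (s ℕ.+ V)

          unchanged : ∀ k → series w (map (λ r → r) (rowsBelow V k)) ≈ rowSeries V k
          unchanged k = reflexive (≡.cong (series w) (Listₚ.map-id (rowsBelow V k)))

          once : ∀ k → series w (map (V ∷_) (rowsBelow V k)) ≈ u * rowSeries V k
          once k = series-map w (V ∷_) (s ℕ.+ V) (w-∷ V) (rowsBelow V k)

          twice : ∀ k → series w (map (λ r → V ∷ V ∷ r) (rowsBelow V k)) ≈ u * u * rowSeries V k
          twice k = trans
            (series-map w (λ r → V ∷ V ∷ r) ((s ℕ.+ V) ℕ.+ (s ℕ.+ V))
              (λ r → ≡.trans (w-∷ V (V ∷ r)) (≡.trans (≡.cong ((s ℕ.+ V) ℕ.+_) (w-∷ V r))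
                (≡.sym (ℕₚ.+-assoc (s ℕ.+ V) (s ℕ.+ V) (w r)))))
              (rowsBelow V k))
            (*-congʳ (^-homo-* q (s ℕ.+ V) (s ℕ.+ V)))

        -- The recursion is divided by length, since the tests `j ≤ᵇ k` in `rowsBelow` compute only
        -- for k equal to 0, 1 or at least 2.
        rowSeries-suc-0 : rowSeries (suc V) 0 ≈ rowSeries V 0
        rowSeries-suc-0 = trans (series-++ w (map (λ r → r) (rowsBelow V 0)) []) (trans (+-identityʳ _) (unchanged 0))

        rowSeries-suc-1 : rowSeries (suc V) 1 ≈ rowSeries V 1 + u * rowSeries V 0
        rowSeries-suc-1 = trans (series-++ w (map (λ r → r) (rowsBelow V 1)) _)
          (+-cong (unchanged 1) (trans (series-++ w (map (V ∷_) (rowsBelow V 0)) [])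
            (trans (+-identityʳ _) (once 0))))

        rowSeries-suc-2+ : ∀ k → rowSeries (suc V) (2 ℕ.+ k) ≈
          rowSeries V (2 ℕ.+ k) + (u * rowSeries V (suc k) + u * u * rowSeries V k)
        rowSeries-suc-2+ k = trans (series-++ w (map (λ r → r) (rowsBelow V (2 ℕ.+ k))) _)
          (+-cong (unchanged (2 ℕ.+ k)) (trans (series-++ w (map (V ∷_) (rowsBelow V (suc k))) _)
            (+-cong (once (suc k)) (trans (series-++ w (map (λ r → V ∷ V ∷ r) (rowsBelow V k)) [])
              (trans (+-identityʳ _) (twice k))))))

      -- There are V values, each used at most twice. This supplies the degree bound required by
      -- `timesLinear-∑`.
      rowSeries-long : ∀ V k → V ℕ.+ V ℕ.< k → rowSeries V k ≈ 0#
      rowSeries-long zero    (suc k) _ = refl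
      rowSeries-long (suc V) (suc (suc k)) (s≤s 2V<k) = begin
        rowSeries (suc V) (2 ℕ.+ k)
          ≈⟨ rowSeries-suc-2+ V k ⟩
        rowSeries V (2 ℕ.+ k) + (u * rowSeries V (suc k) + u * u * rowSeries V k)
          ≈⟨ +-cong (rowSeries-long V (2 ℕ.+ k) (ℕₚ.m≤n⇒m≤1+n (ℕₚ.m≤n⇒m≤1+n lt)))
               (+-cong (*-congˡ (rowSeries-long V (suc k) (ℕₚ.m≤n⇒m≤1+n lt)))
                       (*-congˡ (rowSeries-long V k lt))) ⟩
        0# + (u * 0# + u * u * 0#)
          ≈⟨ solve 1 (λ u → con 0 :+ (u :* con 0 :+ u :* u :* con 0) := con 0) refl u ⟩
        0# ∎
        where
        u = q ^ (s ℕ.+ V)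
        lt : V ℕ.+ V ℕ.< k
        lt = ℕₚ.≤-pred (≡.subst (ℕ._< suc k) (ℕₚ.+-suc V V) 2V<k)

      -- An entry of value at least K contributes a vanishing power of q. Hence the bound on entries
      -- in `arrays` may be raised to the number of factors in the triple product.
      rowSeries-stable : ∀ K → q ^ K ≈ 0# → ∀ d k → rowSeries (d ℕ.+ K) k ≈ rowSeries K k
      rowSeries-stable K q^K≈0 zero    k = refl
      rowSeries-stable K q^K≈0 (suc d) k = trans (dropTop k) (rowSeries-stable K q^K≈0 d k)
        where
        V = d ℕ.+ K
        u≈0 : q ^ (s ℕ.+ V) ≈ 0#
        u≈0 = ^-vanishes q K q^K≈0 (ℕₚ.≤-trans (ℕₚ.m≤n+m K d) (ℕₚ.m≤n+m V s))
        dropTop : ∀ k → rowSeries (suc V) k ≈ rowSeries V k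
        dropTop zero          = rowSeries-suc-0 V
        dropTop (suc zero)    = trans (rowSeries-suc-1 V)
          (trans (+-congˡ (trans (*-congʳ u≈0) (zeroˡ _))) (+-identityʳ _))
        dropTop (suc (suc k)) = trans (rowSeries-suc-2+ V k)
          (trans (+-congˡ (trans (+-cong (trans (*-congʳ u≈0) (zeroˡ _))
                                         (trans (*-congʳ (trans (*-congʳ u≈0) (zeroˡ _))) (zeroˡ _)))
                                 (+-identityʳ _)))
                 (+-identityʳ _))

      module _ (x y : Carrier) (x+y≈1 : x + y ≈ 1#) (xy≈1 : x * y ≈ 1#) where

        private
          -- Admitting the value V multiplies the row polynomial by 1 + uz + u²z² = (1 + xuz)(1 +
          -- yuz) with u = q^(s+V).
          rowSeries-linear : ∀ V k → rowSeries (suc V) k ≈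
            timesLinear (y * q ^ (s ℕ.+ V)) (timesLinear (x * q ^ (s ℕ.+ V)) (rowSeries V)) k
          rowSeries-linear V zero       = rowSeries-suc-0 V
          rowSeries-linear V (suc zero) = begin
            rowSeries (suc V) 1
              ≈⟨ rowSeries-suc-1 V ⟩
            r₁ + u * r₀
              ≈⟨ +-congˡ (*-identityˡ _) ⟨
            r₁ + 1# * (u * r₀)
              ≈⟨ +-congˡ (*-congʳ x+y≈1) ⟨
            r₁ + (x + y) * (u * r₀)
              ≈⟨ solve 5 (λ x y u r₀ r₁ → r₁ :+ (x :+ y) :* (u :* r₀) :=
                                          (r₁ :+ x :* u :* r₀) :+ y :* u :* r₀) refl x y u r₀ r₁ ⟩
            (r₁ + x * u * r₀) + y * u * r₀ ∎
            where
            u  = q ^ (s ℕ.+ V)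
            r₀ = rowSeries V 0
            r₁ = rowSeries V 1
          rowSeries-linear V (suc (suc k)) = begin
            rowSeries (suc V) (2 ℕ.+ k)
              ≈⟨ rowSeries-suc-2+ V k ⟩
            r₂ + (u * r₁ + u * u * r₀)
              ≈⟨ +-congˡ (+-cong (*-identityˡ _) (*-identityˡ _)) ⟨
            r₂ + (1# * (u * r₁) + 1# * (u * u * r₀))
              ≈⟨ +-congˡ (+-cong (*-congʳ x+y≈1) (*-congʳ xy≈1)) ⟨
            r₂ + ((x + y) * (u * r₁) + (x * y) * (u * u * r₀))
              ≈⟨ solve 6 (λ x y u r₀ r₁ r₂ →
                   r₂ :+ ((x :+ y) :* (u :* r₁) :+ (x :* y) :* (u :* u :* r₀)) :=
                   (r₂ :+ x :* u :* r₁) :+ y :* u :* (r₁ :+ x :* u :* r₀)) refl x y u r₀ r₁ r₂ ⟩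
            (r₂ + x * u * r₁) + y * u * (r₁ + x * u * r₀) ∎
            where
            u  = q ^ (s ℕ.+ V)
            r₀ = rowSeries V k
            r₁ = rowSeries V (suc k)
            r₂ = rowSeries V (2 ℕ.+ k)

        rowSeries-product : ∀ w z V →
          ∏ V (λ i → (w + y * q ^ (s ℕ.+ i) * z) * (w + x * q ^ (s ℕ.+ i) * z)) ≈
          ∑ (V ℕ.+ V) (λ i j → w ^ i * (z ^ j * rowSeries V j))
        rowSeries-product w z zero = sym (begin
          1# * (1# * rowSeries 0 0)  ≈⟨ trans (*-identityˡ _) (*-identityˡ _) ⟩
          rowSeries 0 0              ≈⟨ rowSeries-zero ⟩
          1#                         ∎)
        rowSeries-product w z (suc V) = begin
          ∏ V (λ i → (w + y * q ^ (s ℕ.+ i) * z) * (w + x * q ^ (s ℕ.+ i) * z)) *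
          ((w + y * u * z) * (w + x * u * z))
            ≈⟨ trans (*-comm _ _) (*-assoc _ _ _) ⟩
          (w + y * u * z) * ((w + x * u * z) *
          ∏ V (λ i → (w + y * q ^ (s ℕ.+ i) * z) * (w + x * q ^ (s ℕ.+ i) * z)))
            ≈⟨ *-congˡ (*-congˡ (rowSeries-product w z V)) ⟩
          (w + y * u * z) * ((w + x * u * z) * ∑ (V ℕ.+ V) (λ i j → w ^ i * (z ^ j * rowSeries V j)))
            ≈⟨ *-congˡ (timesLinear-∑ w z (x * u) (rowSeries V) (V ℕ.+ V)
                 (rowSeries-long V _ (ℕₚ.n<1+n _))) ⟩
          (w + y * u * z) * ∑ (suc (V ℕ.+ V)) (λ i j → w ^ i * (z ^ j * b j))
            ≈⟨ timesLinear-∑ w z (y * u) b (suc (V ℕ.+ V)) b≈0 ⟩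
          ∑ (2 ℕ.+ (V ℕ.+ V)) (λ i j → w ^ i * (z ^ j * timesLinear (y * u) b j))
            ≈⟨ ∑-cong (2 ℕ.+ (V ℕ.+ V)) (λ i j _ → *-congˡ {w ^ i} (*-congˡ {z ^ j} (rowSeries-linear V j))) ⟨
          ∑ (2 ℕ.+ (V ℕ.+ V)) (λ i j → w ^ i * (z ^ j * rowSeries (suc V) j))
            ≈⟨ reflexive (≡.cong (λ n → ∑ (suc n) (λ i j → w ^ i * (z ^ j * rowSeries (suc V) j)))
                 (≡.sym (ℕₚ.+-suc V V))) ⟩
          ∑ (suc V ℕ.+ suc V) (λ i j → w ^ i * (z ^ j * rowSeries (suc V) j)) ∎
          where
          u = q ^ (s ℕ.+ V)
          b = timesLinear (x * u) (rowSeries V)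
          b≈0 : b (2 ℕ.+ (V ℕ.+ V)) ≈ 0#
          b≈0 = trans (+-cong (rowSeries-long V _ (ℕₚ.m≤n⇒m≤1+n (ℕₚ.n<1+n _)))
                              (trans (*-congˡ (rowSeries-long V _ (ℕₚ.n<1+n _))) (zeroʳ _)))
                      (+-identityˡ 0#)

    topWeight : List ℕ → ℕ
    topWeight r = length r ℕ.+ sum r

    module Top = Rows topWeight 1 ≡.refl
      (λ a r → ≡.cong suc (≡.trans (≡.sym (ℕₚ.+-assoc (length r) a (sum r)))
        (≡.trans (≡.cong (ℕ._+ sum r) (ℕₚ.+-comm (length r) a)) (ℕₚ.+-assoc a (length r) (sum r)))))
    module Bottom = Rows sum 0 ≡.refl (λ a r → ≡.refl)

    -- Each of the k entries weighs one more in a top row. Consequently top rows of length at least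
    -- K contribute nothing.
    topSeries-bottomSeries : ∀ V k → Top.rowSeries V k ≈ q ^ k * Bottom.rowSeries V k
    topSeries-bottomSeries zero    zero    = sym (*-identityˡ _)
    topSeries-bottomSeries zero    (suc k) = sym (zeroʳ _)
    topSeries-bottomSeries (suc V) zero    = trans (Top.rowSeries-suc-0 V)
      (trans (topSeries-bottomSeries V 0) (*-congˡ (sym (Bottom.rowSeries-suc-0 V))))
    topSeries-bottomSeries (suc V) (suc zero) = begin
      Top.rowSeries (suc V) 1
        ≈⟨ Top.rowSeries-suc-1 V ⟩
      Top.rowSeries V 1 + q * q ^ V * Top.rowSeries V 0
        ≈⟨ +-cong (topSeries-bottomSeries V 1) (*-congˡ (topSeries-bottomSeries V 0)) ⟩
      q * 1# * Bottom.rowSeries V 1 + q * q ^ V * (1# * Bottom.rowSeries V 0)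
        ≈⟨ solve 4 (λ q u r₁ r₀ → q :* con 1 :* r₁ :+ q :* u :* (con 1 :* r₀) :=
                                  q :* con 1 :* (r₁ :+ u :* r₀)) refl q (q ^ V) _ _ ⟩
      q * 1# * (Bottom.rowSeries V 1 + q ^ V * Bottom.rowSeries V 0)
        ≈⟨ *-congˡ (Bottom.rowSeries-suc-1 V) ⟨
      q * 1# * Bottom.rowSeries (suc V) 1 ∎
    topSeries-bottomSeries (suc V) (suc (suc k)) = begin
      Top.rowSeries (suc V) (2 ℕ.+ k)
        ≈⟨ Top.rowSeries-suc-2+ V k ⟩
      Top.rowSeries V (2 ℕ.+ k) + (q * u * Top.rowSeries V (suc k) + (q * u) * (q * u) * Top.rowSeries V k)
        ≈⟨ +-cong (topSeries-bottomSeries V (2 ℕ.+ k))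
             (+-cong (*-congˡ (topSeries-bottomSeries V (suc k))) (*-congˡ (topSeries-bottomSeries V k))) ⟩
      q * (q * p) * r₂ + (q * u * (q * p * r₁) + (q * u) * (q * u) * (p * r₀))
        ≈⟨ solve 6 (λ q u p r₂ r₁ r₀ →
             q :* (q :* p) :* r₂ :+ (q :* u :* (q :* p :* r₁) :+ (q :* u) :* (q :* u) :* (p :* r₀)) :=
             q :* (q :* p) :* (r₂ :+ (u :* r₁ :+ u :* u :* r₀))) refl q u p r₂ r₁ r₀ ⟩
      q * (q * p) * (r₂ + (u * r₁ + u * u * r₀))
        ≈⟨ *-congˡ (Bottom.rowSeries-suc-2+ V k) ⟨
      q * (q * p) * Bottom.rowSeries (suc V) (2 ℕ.+ k) ∎
      where
      u  = q ^ V
      p  = q ^ k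
      r₂ = Bottom.rowSeries V (2 ℕ.+ k)
      r₁ = Bottom.rowSeries V (suc k)
      r₀ = Bottom.rowSeries V k

-- Extraction of the coefficient of z⁻¹.

module Theta {c ℓ} (R : CommutativeSemiring c ℓ) where
  open Exponent
  open CommutativeSemiring R hiding (zero)
  open AntidiagonalSum R
  open TripleProduct R
  open Euler R using (euler)

  module _ (m : Carrier) (m+1≈0 : m + 1# ≈ 0#) (q : Carrier) (K : ℕ) (q^K≈0 : q ^ K ≈ 0#)
           (x y : Carrier) (x+y≈1 : x + y ≈ 1#) (xy≈1 : x * y ≈ 1#)
           (N : ℕ) (2K≤1+N : K ℕ.+ K ℕ.≤ suc N) where

    private
      D = suc N ℕ.+ suc N

      open PowerSeries R D
      open ConstantEuler R D
      module B = CommutativeSemiring commutativeSemiring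
      module B∏ = TripleProduct commutativeSemiring
      module B∑ = AntidiagonalSum commutativeSemiring
      module RowsR = RowSeries R
      module RowsB = RowSeries commutativeSemiring
      open B∏ using () renaming (_^_ to _^ᴮ_; ∏ to ∏ᴮ)

      qᴮ xᴮ yᴮ : Series
      qᴮ = const q
      xᴮ = const x
      yᴮ = const y

      xᴮ+yᴮ≋1 : (xᴮ ⊕ yᴮ) ≋ const 1#
      xᴮ+yᴮ≋1 = B.trans (B.sym (const-+ x y)) (const-cong x+y≈1)

      xᴮyᴮ≋1 : (xᴮ ⊛ yᴮ) ≋ const 1#
      xᴮyᴮ≋1 = B.trans (B.sym (const-* x y)) (const-cong xy≈1)

      Eᴮ : Series
      Eᴮ = Euler.euler commutativeSemiring (const m) qᴮ K

      const-series : ∀ (w : List ℕ → ℕ) l → RowsB.series qᴮ w l ≋ const (RowsR.series q w l)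
      const-series w []      = B.sym const-0
      const-series w (r ∷ l) =
        B.trans (B.+-cong (B.sym (const-^ q (w r))) (const-series w l)) (B.sym (const-+ _ _))

      polynomial : (ℕ → ℕ → Carrier) → Series
      polynomial F = B∑.∑ D (λ i j → const (F i j) ⊛ X ^ᴮ i)

      triple : Carrier → Series
      triple a = ∏ᴮ (suc N) (λ i → const 1# ⊕ (const a ⊛ X) ⊛ qᴮ ^ᴮ suc i) ⊛
                 ∏ᴮ (suc N) (λ i → const a ⊛ X ⊕ qᴮ ^ᴮ i)

      triple-polynomial : ∀ a → (Eᴮ ⊛ triple a) ≋ polynomial (λ i _ → a ^ i * q ^ shifted (suc N) i)
      triple-polynomial a = B.trans
        (Euler.MinusOne.Truncated.triple-product commutativeSemiring
          (const m) (const-minus-one m m+1≈0) qᴮ K (const-nilpotent q K q^K≈0)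
          (suc N) 2K≤1+N (const a ⊛ X))
        (B∑.∑-cong D λ i j _ → begin
          (const a ⊛ X) ^ᴮ i ⊛ qᴮ ^ᴮ shifted (suc N) i
            ≈⟨ B.*-congʳ (^ᴮ-distrib-* (const a) X i) ⟩
          const a ^ᴮ i ⊛ X ^ᴮ i ⊛ qᴮ ^ᴮ shifted (suc N) i
            ≈⟨ xy∙z≈xz∙y (const a ^ᴮ i) (X ^ᴮ i) (qᴮ ^ᴮ shifted (suc N) i) ⟩
          const a ^ᴮ i ⊛ qᴮ ^ᴮ shifted (suc N) i ⊛ X ^ᴮ i
            ≈⟨ B.*-congʳ (B.*-cong (const-^ a i) (const-^ q (shifted (suc N) i))) ⟨
          const (a ^ i) ⊛ const (q ^ shifted (suc N) i) ⊛ X ^ᴮ i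
            ≈⟨ B.*-congʳ (const-* (a ^ i) (q ^ shifted (suc N) i)) ⟨
          const (a ^ i * q ^ shifted (suc N) i) ⊛ X ^ᴮ i ∎)
        where
        open import Algebra.Properties.CommutativeSemiring.Exp commutativeSemiring
          using () renaming (^-distrib-* to ^ᴮ-distrib-*)
        open import Algebra.Properties.CommutativeSemigroup B.*-commutativeSemigroup using (xy∙z≈xz∙y)
        open SetoidReasoning B.setoid

      one^n : ∀ n → (const 1# ^ᴮ n) ≋ const 1#
      one^n zero    = B.refl
      one^n (suc n) = B.trans (B.*-identityˡ _) (one^n n)

      top bottom : ℕ → Carrier
      top    = RowsR.Top.rowSeries q (suc N)
      bottom = RowsR.Bottom.rowSeries q (suc N)

      topᴮ bottomᴮ : Series
      topᴮ    = ∏ᴮ (suc N) (λ i → (const 1# ⊕ yᴮ ⊛ qᴮ ^ᴮ suc i ⊛ X) ⊛ (const 1# ⊕ xᴮ ⊛ qᴮ ^ᴮ suc i ⊛ X))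
      bottomᴮ = ∏ᴮ (suc N) (λ i → (X ⊕ yᴮ ⊛ qᴮ ^ᴮ i ⊛ const 1#) ⊛ (X ⊕ xᴮ ⊛ qᴮ ^ᴮ i ⊛ const 1#))

      topᴮ-polynomial : topᴮ ≋ polynomial (λ i _ → top i)
      topᴮ-polynomial = begin
        topᴮ
          ≈⟨ RowsB.Top.rowSeries-product qᴮ xᴮ yᴮ xᴮ+yᴮ≋1 xᴮyᴮ≋1 (const 1#) X (suc N) ⟩
        B∑.∑ D (λ i j → const 1# ^ᴮ i ⊛ (X ^ᴮ j ⊛ RowsB.Top.rowSeries qᴮ (suc N) j))
          ≈⟨ B∑.∑-cong D (λ i j _ → B.trans (B.*-congʳ (one^n i)) (B.trans (B.*-identityˡ _)
               (B.trans (B.*-comm (X ^ᴮ j) _)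
                 (B.*-congʳ (const-series (RowsR.topWeight q) (rowsBelow (suc N) j)))))) ⟩
        B∑.∑ D (λ i j → const (top j) ⊛ X ^ᴮ j)
          ≈⟨ B∑.∑-flip D {λ i j → const (top j) ⊛ X ^ᴮ j} ⟩
        polynomial (λ i _ → top i) ∎
        where open SetoidReasoning B.setoid

      bottomᴮ-polynomial : bottomᴮ ≋ polynomial (λ _ j → bottom j)
      bottomᴮ-polynomial = begin
        bottomᴮ
          ≈⟨ RowsB.Bottom.rowSeries-product qᴮ xᴮ yᴮ xᴮ+yᴮ≋1 xᴮyᴮ≋1 X (const 1#) (suc N) ⟩
        B∑.∑ D (λ i j → X ^ᴮ i ⊛ (const 1# ^ᴮ j ⊛ RowsB.Bottom.rowSeries qᴮ (suc N) j))
          ≈⟨ B∑.∑-cong D (λ i j _ → B.trans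
               (B.*-congˡ (B.trans (B.*-congʳ (one^n j)) (B.trans (B.*-identityˡ _)
                 (const-series sum (rowsBelow (suc N) j)))))
               (B.*-comm (X ^ᴮ i) (const (bottom j)))) ⟩
        polynomial (λ _ j → bottom j) ∎
        where open SetoidReasoning B.setoid

      factorization : (topᴮ ⊛ bottomᴮ) ≋ (triple x ⊛ triple y)
      factorization = begin
        topᴮ ⊛ bottomᴮ
          ≈⟨ B.*-cong
               (B∏.∏-cong (suc N) (λ i → B.trans
                 (B.*-comm (const 1# ⊕ yᴮ ⊛ qᴮ ^ᴮ suc i ⊛ X) (const 1# ⊕ xᴮ ⊛ qᴮ ^ᴮ suc i ⊛ X))
                 (B.*-cong (B.+-congˡ (xy∙z≈xz∙y xᴮ (qᴮ ^ᴮ suc i) X))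
                           (B.+-congˡ (xy∙z≈xz∙y yᴮ (qᴮ ^ᴮ suc i) X)))))
               (B∏.∏-cong (suc N) (λ i → B.sym (omega-factorsᴮ (qᴮ ^ᴮ i)))) ⟩
        ∏ᴮ (suc N) (λ i → (const 1# ⊕ xᴮ ⊛ X ⊛ qᴮ ^ᴮ suc i) ⊛ (const 1# ⊕ yᴮ ⊛ X ⊛ qᴮ ^ᴮ suc i)) ⊛
        ∏ᴮ (suc N) (λ i → (xᴮ ⊛ X ⊕ qᴮ ^ᴮ i) ⊛ (yᴮ ⊛ X ⊕ qᴮ ^ᴮ i))
          ≈⟨ B.*-cong (B∏.∏-* (suc N)) (B∏.∏-* (suc N)) ⟩
        (∏ᴮ (suc N) (λ i → const 1# ⊕ xᴮ ⊛ X ⊛ qᴮ ^ᴮ suc i) ⊛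
         ∏ᴮ (suc N) (λ i → const 1# ⊕ yᴮ ⊛ X ⊛ qᴮ ^ᴮ suc i)) ⊛
        (∏ᴮ (suc N) (λ i → xᴮ ⊛ X ⊕ qᴮ ^ᴮ i) ⊛ ∏ᴮ (suc N) (λ i → yᴮ ⊛ X ⊕ qᴮ ^ᴮ i))
          ≈⟨ interchange (∏ᴮ (suc N) (λ i → const 1# ⊕ xᴮ ⊛ X ⊛ qᴮ ^ᴮ suc i)) _
                         (∏ᴮ (suc N) (λ i → xᴮ ⊛ X ⊕ qᴮ ^ᴮ i)) _ ⟩
        triple x ⊛ triple y ∎
        where
        open import Algebra.Properties.CommutativeSemigroup B.*-commutativeSemigroup
          using (xy∙z≈xz∙y; interchange)
        open SetoidReasoning B.setoid
        omega-factorsᴮ = RowsB.omega-factors xᴮ yᴮ xᴮ+yᴮ≋1 xᴮyᴮ≋1 X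

      theta-series : (const (euler m q K) ⊛ (const (euler m q K) ⊛ (topᴮ ⊛ bottomᴮ))) ≋
                     (polynomial (λ i _ → x ^ i * q ^ shifted (suc N) i) ⊛
                      polynomial (λ i _ → y ^ i * q ^ shifted (suc N) i))
      theta-series = begin
        const (euler m q K) ⊛ (const (euler m q K) ⊛ (topᴮ ⊛ bottomᴮ))
          ≈⟨ B.*-cong (const-euler m q K) (B.*-cong (const-euler m q K) factorization) ⟩
        Eᴮ ⊛ (Eᴮ ⊛ (triple x ⊛ triple y))
          ≈⟨ B.*-assoc Eᴮ Eᴮ (triple x ⊛ triple y) ⟨
        (Eᴮ ⊛ Eᴮ) ⊛ (triple x ⊛ triple y)
          ≈⟨ interchange Eᴮ Eᴮ (triple x) (triple y) ⟩
        (Eᴮ ⊛ triple x) ⊛ (Eᴮ ⊛ triple y)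
          ≈⟨ B.*-cong (triple-polynomial x) (triple-polynomial y) ⟩
        polynomial (λ i _ → x ^ i * q ^ shifted (suc N) i) ⊛
        polynomial (λ i _ → y ^ i * q ^ shifted (suc N) i) ∎
        where
        open import Algebra.Properties.CommutativeSemigroup B.*-commutativeSemigroup using (interchange)
        open SetoidReasoning B.setoid

      -- The variable `X` is z here, and `bottomᴮ` is z^D times a polynomial in z⁻¹. So z⁻¹
      -- corresponds to degree D - 1, the last one that precision D retains.
      L = N ℕ.+ suc N

      L<D : L ℕ.< D
      L<D = ℕₚ.n<1+n L

      -- In degree D - 1 the complementary indices D - k and D - l are l + 1 and k + 1. The second
      -- is the reason why bottom rows come out one longer than top rows.
      polynomial-product : ∀ F G →
        (polynomial F ⊛ polynomial G) L ≈ ∑ L (λ k l → F k (suc l) * G l (suc k))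
      polynomial-product F G = ∑-cong L λ k l eq → *-cong
        (polynomial-coeff D F k (suc l) (≡.trans (ℕₚ.+-suc k l) (≡.cong suc eq))
          (s≤s (≡.subst (k ℕ.≤_) eq (ℕₚ.m≤m+n k l))))
        (polynomial-coeff D G l (suc k) (≡.trans (ℕₚ.+-suc l k) (≡.cong suc (≡.trans (ℕₚ.+-comm l k) eq)))
          (s≤s (≡.subst (l ℕ.≤_) eq (ℕₚ.m≤n+m l k))))

    -- As k + l = 2(N + 1) - 1, the distances of k and l from the centre N + 1 are d and -1 - d, and
    -- their exponents agree: each term on the right is a multiple of q^(d(d+1)).
    theta-identity : euler m q K * (euler m q K *
        ∑ (N ℕ.+ suc N) (λ k _ → RowsR.Top.rowSeries q (suc N) k * RowsR.Bottom.rowSeries q (suc N) (suc k))) ≈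
      ∑ (N ℕ.+ suc N) (λ k l → (x ^ k * q ^ shifted (suc N) k) * (y ^ l * q ^ shifted (suc N) l))
    theta-identity = begin
      E * (E * ∑ L (λ k _ → top k * bottom (suc k)))
        ≈⟨ *-congˡ (*-congˡ (trans
              (coeff (B.*-cong topᴮ-polynomial bottomᴮ-polynomial) L L<D)
              (polynomial-product (λ i _ → top i) (λ _ j → bottom j)))) ⟨
      E * (E * (topᴮ ⊛ bottomᴮ) L)
        ≈⟨ trans (const-⊛-coeff E (const E ⊛ (topᴮ ⊛ bottomᴮ)) L)
                  (*-congˡ (const-⊛-coeff E (topᴮ ⊛ bottomᴮ) L)) ⟨
      (const E ⊛ (const E ⊛ (topᴮ ⊛ bottomᴮ))) L
        ≈⟨ coeff theta-series L L<D ⟩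
      (polynomial (λ i _ → x ^ i * q ^ shifted (suc N) i) ⊛
       polynomial (λ i _ → y ^ i * q ^ shifted (suc N) i)) L
        ≈⟨ polynomial-product (λ i _ → x ^ i * q ^ shifted (suc N) i)
                              (λ i _ → y ^ i * q ^ shifted (suc N) i) ⟩
      ∑ L (λ k l → (x ^ k * q ^ shifted (suc N) k) * (y ^ l * q ^ shifted (suc N) l)) ∎
      where
      open SetoidReasoning setoid
      E = euler m q K

-- Frobenius in characteristic 5.

module Characteristic5 {c ℓ} (R : CommutativeSemiring c ℓ) where
  open CommutativeSemiring R hiding (zero)
  open TripleProduct R
  open CommutativeExp R using (^-distrib-*)
  open Mult semiring using (_×_; ×-assocˡ; ×-congˡ)
  open Euler R using (euler; geometric; module MinusOne)
  open SetoidReasoning setoid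
  open SemiringSolver R using (solve; con; _:+_; _:*_; _:=_)

  module _ (five : 1# + 1# + 1# + 1# + 1# ≈ 0#) where

    frobenius : ∀ x y → (x + y) ^ 5 ≈ x ^ 5 + y ^ 5
    frobenius x y = begin
      (x + y) ^ 5
        ≈⟨ solve 2 (λ x y →
             -- `cross` is the sum of the mixed terms of (x + y)⁵ divided by 5.
             let z = x :+ y; cross = x :* x :* x :* x :* y :+ con 2 :* (x :* x :* x :* y :* y) :+
                                     con 2 :* (x :* x :* y :* y :* y) :+ x :* y :* y :* y :* y in
             z :* (z :* (z :* (z :* (z :* con 1)))) :=
             x :* (x :* (x :* (x :* (x :* con 1)))) :+ y :* (y :* (y :* (y :* (y :* con 1)))) :+
             (con 1 :+ con 1 :+ con 1 :+ con 1 :+ con 1) :* cross) refl x y ⟩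
      x ^ 5 + y ^ 5 + (1# + 1# + 1# + 1# + 1#) * _
        ≈⟨ +-congˡ (trans (*-congʳ five) (zeroˡ _)) ⟩
      x ^ 5 + y ^ 5 + 0#
        ≈⟨ +-identityʳ _ ⟩
      x ^ 5 + y ^ 5 ∎

    ×-vanishes : ∀ n z → n % 5 ≡ 0 → n × z ≈ 0#
    ×-vanishes n z n%5≡0 = begin
      n × z                ≈⟨ ×-congˡ (≡.trans (m≡m%n+[m/n]*n n 5) (≡.cong (ℕ._+ n / 5 ℕ.* 5) n%5≡0)) ⟩
      (n / 5 ℕ.* 5) × z    ≈⟨ ×-congˡ (ℕₚ.*-comm (n / 5) 5) ⟩
      (5 ℕ.* (n / 5)) × z  ≈⟨ ×-assocˡ z 5 (n / 5) ⟨
      5 × ((n / 5) × z)    ≈⟨ solve 1 (λ w → w :+ (w :+ (w :+ (w :+ (w :+ con 0)))) :=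
                                (con 1 :+ con 1 :+ con 1 :+ con 1 :+ con 1) :* w) refl ((n / 5) × z) ⟩
      (1# + 1# + 1# + 1# + 1#) * ((n / 5) × z)
                           ≈⟨ trans (*-congʳ five) (zeroˡ _) ⟩
      0#                   ∎

    module _ (m : Carrier) (m+1≈0 : m + 1# ≈ 0#) where

      -- Frobenius applied to (1 - x) + x = 1 gives (1 - x)⁵ + x⁵ = 1; adding (m + 1)x⁵ = 0 moves x⁵
      -- across.
      frobenius-1-x : ∀ x → (1# + m * x) ^ 5 ≈ 1# + m * x ^ 5
      frobenius-1-x x = begin
        p ^ 5
          ≈⟨ +-identityʳ _ ⟨
        p ^ 5 + 0#
          ≈⟨ +-congˡ (trans (*-congʳ m+1≈0) (zeroˡ _)) ⟨
        p ^ 5 + (m + 1#) * x ^ 5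
          ≈⟨ solve 3 (λ a m b → a :+ (m :+ con 1) :* b := (a :+ b) :+ m :* b) refl (p ^ 5) m (x ^ 5) ⟩
        (p ^ 5 + x ^ 5) + m * x ^ 5
          ≈⟨ +-congʳ (trans (sym (frobenius p x)) (^-congˡ 5 (MinusOne.complement m m+1≈0 x))) ⟩
        1# ^ 5 + m * x ^ 5
          ≈⟨ solve 2 (λ m b → con 1 :* (con 1 :* (con 1 :* (con 1 :* (con 1 :* con 1)))) :+ m :* b :=
                              con 1 :+ m :* b) refl m (x ^ 5) ⟩
        1# + m * x ^ 5 ∎
        where p = 1# + m * x

      -- E⁵ is the product of the 1 - q^(5(i+1)), each inverted by a finite geometric series. The
      -- explicit inverse makes visible that it involves only powers of q⁵.
      euler^5-inverse : ∀ q K → q ^ K ≈ 0# →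
                        euler m q K ^ 5 * ∏ K (λ i → geometric K (q ^ (suc i ℕ.* 5))) ≈ 1#
      euler^5-inverse q K q^K≈0 = begin
        euler m q K ^ 5 * ∏ K (λ i → geometric K (q ^ (suc i ℕ.* 5)))
          ≈⟨ *-congʳ (trans (∏-^5 K) (∏-cong K λ i → trans (frobenius-1-x (q ^ suc i))
               (+-congˡ (*-congˡ (^-assocʳ q (suc i) 5))))) ⟩
        ∏ K (λ i → 1# + m * q ^ (suc i ℕ.* 5)) * ∏ K (λ i → geometric K (q ^ (suc i ℕ.* 5)))
          ≈⟨ ∏-* K ⟨
        ∏ K (λ i → (1# + m * q ^ (suc i ℕ.* 5)) * geometric K (q ^ (suc i ℕ.* 5)))
          ≈⟨ ∏-one K (λ i → MinusOne.geometric-inverse m m+1≈0 K (q ^ (suc i ℕ.* 5))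
               (MinusOne.Truncated.power-vanishes m m+1≈0 q K q^K≈0 (4 ℕ.+ i ℕ.* 5))) ⟩
        1# ∎
        where
        ∏-^5 : ∀ n {f} → ∏ n f ^ 5 ≈ ∏ n (λ i → f i ^ 5)
        ∏-^5 zero        = solve 0 (con 1 :* (con 1 :* (con 1 :* (con 1 :* (con 1 :* con 1)))) := con 1) refl
        ∏-^5 (suc n) {f} = trans (^-distrib-* (∏ n f) (f n) 5) (*-congʳ (∏-^5 n))

-- 𝔽₅[x]/(x² − x + 1), with (a , b) standing for a + b x
module Mod5 where
  open import Data.Nat using (_+_; _*_)
  open import Data.Nat.Properties
  open ≡ using (refl; cong; cong₂; sym; trans)

  infix 4 _≈₅_
  infixl 6 _+₅_
  infixl 7 _*₅_

  record _≈₅_ (u v : ℕ ⊗ ℕ) : Set where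
    constructor _,_
    field
      fst : proj₁ u % 5 ≡ proj₁ v % 5
      snd : proj₂ u % 5 ≡ proj₂ v % 5
  open _≈₅_ public

  -- The product uses x² = x - 1, with -1 written as 4.
  _+₅_ _*₅_ : ℕ ⊗ ℕ → ℕ ⊗ ℕ → ℕ ⊗ ℕ
  (a , b) +₅ (c , d) = a + c , b + d
  (a , b) *₅ (c , d) = a * c + 4 * (b * d) , a * d + b * c + b * d

  private
    +-cong₅ : ∀ {a b c d} → a % 5 ≡ b % 5 → c % 5 ≡ d % 5 → (a + c) % 5 ≡ (b + d) % 5
    +-cong₅ {a} {b} {c} {d} p q = trans (%-distribˡ-+ a c 5)
      (trans (cong₂ (λ m n → (m + n) % 5) p q) (sym (%-distribˡ-+ b d 5)))

    *-cong₅ : ∀ {a b c d} → a % 5 ≡ b % 5 → c % 5 ≡ d % 5 → (a * c) % 5 ≡ (b * d) % 5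
    *-cong₅ {a} {b} {c} {d} p q = trans (%-distribˡ-* a c 5)
      (trans (cong₂ (λ m n → (m * n) % 5) p q) (sym (%-distribˡ-* b d 5)))

    pointwise : ∀ {a b c d} → a ≡ c → b ≡ d → (a , b) ≈₅ (c , d)
    pointwise p q = cong (_% 5) p , cong (_% 5) q

    *₅-cong : ∀ {u u′ v v′} → u ≈₅ u′ → v ≈₅ v′ → (u *₅ v) ≈₅ (u′ *₅ v′)
    *₅-cong {a , b} {a′ , b′} {c , d} {c′ , d′} (a≈ , b≈) (c≈ , d≈) =
      +-cong₅ {a * c} {a′ * c′} (*-cong₅ {a} {a′} a≈ c≈)
              (*-cong₅ {4} {4} {b * d} {b′ * d′} refl (*-cong₅ {b} {b′} b≈ d≈)) ,
      +-cong₅ {a * d + b * c} {a′ * d′ + b′ * c′}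
        (+-cong₅ {a * d} {a′ * d′} (*-cong₅ {a} {a′} a≈ d≈) (*-cong₅ {b} {b′} b≈ c≈))
        (*-cong₅ {b} {b′} b≈ d≈)

    isEquivalence : IsEquivalence _≈₅_
    isEquivalence = record
      { refl  = refl , refl
      ; sym   = λ (p , q) → sym p , sym q
      ; trans = λ (p , q) (r , s) → trans p r , trans q s
      }

    assoc₁ : ∀ a b c d e f → (a * c + 4 * (b * d)) * e + 4 * ((a * d + b * c + b * d) * f) ≡
                             a * (c * e + 4 * (d * f)) + 4 * (b * (c * f + d * e + d * f))
    assoc₁ = solve-∀

    assoc₂ : ∀ a b c d e f →
      (a * c + 4 * (b * d)) * f + (a * d + b * c + b * d) * e + (a * d + b * c + b * d) * f ≡
      a * (c * f + d * e + d * f) + b * (c * e + 4 * (d * f)) + b * (c * f + d * e + d * f)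
    assoc₂ = solve-∀

    comm₁ : ∀ a b c d → a * c + 4 * (b * d) ≡ c * a + 4 * (d * b)
    comm₁ = solve-∀

    comm₂ : ∀ a b c d → a * d + b * c + b * d ≡ c * b + d * a + d * b
    comm₂ = solve-∀

    identity₁ : ∀ a b → 1 * a + 4 * (0 * b) ≡ a
    identity₁ = solve-∀

    identity₂ : ∀ a b → 1 * b + 0 * a + 0 * b ≡ b
    identity₂ = solve-∀

    identityʳ₁ : ∀ a b → a * 1 + 4 * (b * 0) ≡ a
    identityʳ₁ = solve-∀

    identityʳ₂ : ∀ a b → a * 0 + b * 1 + b * 0 ≡ b
    identityʳ₂ = solve-∀

    distrib₁ : ∀ a b c d e f → (c + e) * a + 4 * ((d + f) * b) ≡ (c * a + 4 * (d * b)) + (e * a + 4 * (f * b))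
    distrib₁ = solve-∀

    distrib₂ : ∀ a b c d e f → (c + e) * b + (d + f) * a + (d + f) * b ≡
                               (c * b + d * a + d * b) + (e * b + f * a + f * b)
    distrib₂ = solve-∀

  commutativeSemiring : CommutativeSemiring 0ℓ 0ℓ
  commutativeSemiring = record
    { Carrier = ℕ ⊗ ℕ
    ; _≈_ = _≈₅_
    ; _+_ = _+₅_
    ; _*_ = _*₅_
    ; 0# = 0 , 0
    ; 1# = 1 , 0
    ; isCommutativeSemiring = isCommutativeSemiringˡ record
      { +-isCommutativeMonoid = record
        { isMonoid = record
          { isSemigroup = record
            { isMagma = record
              { isEquivalence = isEquivalence
              ; ∙-cong = λ { {a , b} {a′ , b′} (p , q) (r , s) → +-cong₅ {a} {a′} p r , +-cong₅ {b} {b′} q s }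
              }
            ; assoc = λ (a , b) (c , d) (e , f) → pointwise (+-assoc a c e) (+-assoc b d f)
            }
          ; identity = (λ _ → refl , refl) ,
                       (λ (a , b) → pointwise (+-identityʳ a) (+-identityʳ b))
          }
        ; comm = λ (a , b) (c , d) → pointwise (+-comm a c) (+-comm b d)
        }
      ; *-isCommutativeMonoid = record
        { isMonoid = record
          { isSemigroup = record
            { isMagma = record { isEquivalence = isEquivalence ; ∙-cong = *₅-cong }
            ; assoc = λ (a , b) (c , d) (e , f) →
                pointwise (assoc₁ a b c d e f) (assoc₂ a b c d e f)
            }
          ; identity = (λ (a , b) → pointwise (identity₁ a b) (identity₂ a b)) ,
                       (λ (a , b) → pointwise (identityʳ₁ a b) (identityʳ₂ a b))
          }
        ; comm = λ (a , b) (c , d) → pointwise (comm₁ a b c d) (comm₂ a b c d)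
        }
      ; distribʳ = λ (a , b) (c , d) (e , f) →
          pointwise (distrib₁ a b c d e f) (distrib₂ a b c d e f)
      ; zeroˡ = λ _ → refl , refl
      }
    }

  open CommutativeSemiring commutativeSemiring using (semiring; 1#)
  open Mult semiring using () renaming (_×_ to _×₅_)

  -- Exact in ℕ, as representatives are never reduced; it carries the vanishing in the ring back to
  -- the count itself.
  ×₅-proj₁ : ∀ n → proj₁ (n ×₅ 1#) ≡ n
  ×₅-proj₁ zero    = refl
  ×₅-proj₁ (suc n) = cong suc (×₅-proj₁ n)

-- The congruence for a single coefficient.

module Congruence {c ℓ} (R : CommutativeSemiring c ℓ) where
  open Exponent
  open Residue
  open CommutativeSemiring R using (Carrier; _≈_; _+_; _*_; 0#; 1#)
  private module R = CommutativeSemiring R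
  open Mult R.semiring using (_×_)

  module _ (five : 1# + 1# + 1# + 1# + 1# ≈ 0#)
           (x y : Carrier) (x+y≈1 : x + y ≈ 1#) (xy≈1 : x * y ≈ 1#) (n : ℕ) where

    private
      -- K = n + 1 just retains the coefficient of qⁿ. The centre N + 1 = 5K is at least 2K, as the
      -- limit of the triple product requires, and divisible by 5, so that centring does not disturb
      -- residues.
      K N : ℕ
      K = suc n
      N = 4 ℕ.+ n ℕ.* 5

      K≤N : K ℕ.≤ N
      K≤N = s≤s (ℕₚ.≤-trans (ℕₚ.m≤m*n n 5) (ℕₚ.m≤n+m (n ℕ.* 5) 3))

      2K≤1+N : K ℕ.+ K ℕ.≤ suc N
      2K≤1+N = ℕₚ.≤-trans (ℕₚ.≤-reflexive (≡.trans (≡.cong (K ℕ.+_) (≡.sym (ℕₚ.+-identityʳ K))) (ℕₚ.*-comm 2 K)))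
                          (ℕₚ.*-monoʳ-≤ K {2} {5} (s≤s (s≤s z≤n)))

      open PowerSeries R K
      open ConstantEuler R K
      open Support R K
      module A = CommutativeSemiring commutativeSemiring
      module A∑ = AntidiagonalSum commutativeSemiring
      open TripleProduct commutativeSemiring using (_^_; ^-congˡ; ^-assocʳ; ∏)
      open Mult A.semiring using () renaming (_×_ to _×ᴬ_)
      open RowSeries commutativeSemiring

      m : Series
      m = const (1# + 1# + 1# + 1#)

      m+1≋0 : (m ⊕ const 1#) ≋ A.0#
      m+1≋0 = const-minus-one (1# + 1# + 1# + 1#) five

      fiveᴬ : (const 1# ⊕ const 1# ⊕ const 1# ⊕ const 1# ⊕ const 1#) ≋ A.0#
      fiveᴬ = A.trans (A.+-congʳ (A.sym (A.trans (const-+ (1# + 1# + 1#) 1#)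
        (A.+-congʳ (A.trans (const-+ (1# + 1#) 1#) (A.+-congʳ (const-+ 1# 1#))))))) m+1≋0

      X^K≋0 : (X ^ K) ≋ A.0#
      X^K≋0 = coeffwise λ i i<K → X^-coeff-≢ K i λ K≡i → ℕₚ.<-irrefl (≡.sym K≡i) i<K

      E : Series
      E = Euler.euler commutativeSemiring m X K

      top bottom : ℕ → ℕ → Series
      top    = Top.rowSeries X
      bottom = Bottom.rowSeries X

      generating : Series
      generating = A∑.∑ (N ℕ.+ suc N) (λ k _ → top (suc N) k ⊛ bottom (suc N) (suc k))

      -- `W` is the inverse of E⁵, and `μ` is the sign in front of E³ in Jacobi's identity.
      theta jacobi W μ : Series
      theta  = A∑.∑ (N ℕ.+ suc N) (λ k l →
                 (const x ^ k ⊛ X ^ shifted (suc N) k) ⊛ (const y ^ l ⊛ X ^ shifted (suc N) l))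
      jacobi = A∑.∑ (suc N ℕ.+ suc N) (λ i j →
                 X ^ shifted (suc N) i ⊛ ((3 ℕ.+ i) ×ᴬ m ^ suc (3 ℕ.+ i)))
      W = ∏ K (λ i → Euler.geometric commutativeSemiring K (X ^ (suc i ℕ.* 5)))
      μ = m ^ (3 ℕ.+ N)

      theta-equation : (E ⊛ (E ⊛ generating)) ≋ theta
      theta-equation = Theta.theta-identity commutativeSemiring m m+1≋0 X K X^K≋0
        (const x) (const y) (A.trans (A.sym (const-+ x y)) (const-cong x+y≈1))
        (A.trans (A.sym (const-* x y)) (const-cong xy≈1)) N 2K≤1+N

      -- The shift 3 makes the coefficient of q^{i(i+1)/2} a multiple of 5 exactly when 5 ∣ 2i + 1.
      jacobi-equation : (μ ⊛ (E ⊛ (E ⊛ E))) ≋ jacobi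
      jacobi-equation = Jacobi.jacobi commutativeSemiring m m+1≋0 X K X^K≋0 N K≤N 2K≤1+N 3

      μ²≋1 : (μ ⊛ μ) ≋ const 1#
      μ²≋1 = begin
        μ ⊛ μ                    ≈⟨ ^-distrib-* m m (3 ℕ.+ N) ⟨
        (m ⊛ m) ^ (3 ℕ.+ N)      ≈⟨ ^-congˡ (3 ℕ.+ N) (Euler.MinusOne.m²≈1 commutativeSemiring m m+1≋0) ⟩
        const 1# ^ (3 ℕ.+ N)     ≈⟨ one^ (3 ℕ.+ N) ⟩
        const 1#                 ∎
        where
        open SetoidReasoning A.setoid
        open CommutativeExp commutativeSemiring using (^-distrib-*)
        one^ : ∀ k → (const 1# ^ k) ≋ const 1#
        one^ zero    = A.refl
        one^ (suc k) = A.trans (A.*-identityˡ _) (one^ k)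

      -- Insert 1 = μ²E⁵W: two copies of E turn `generating` into `theta`, the other three with one
      -- μ form `jacobi`, and μW is left, a series in q⁵ that preserves residues of exponents.
      generating-factors : generating ≋ ((theta ⊛ jacobi) ⊛ (μ ⊛ W))
      generating-factors = begin
        generating
          ≈⟨ A.trans (A.*-congʳ μ²≋1) (A.*-identityˡ generating) ⟨
        (μ ⊛ μ) ⊛ generating
          ≈⟨ A.*-congˡ (A.trans (A.*-congʳ (Characteristic5.euler^5-inverse commutativeSemiring fiveᴬ
               m m+1≋0 X K X^K≋0)) (A.*-identityˡ generating)) ⟨
        (μ ⊛ μ) ⊛ ((E ^ 5 ⊛ W) ⊛ generating)
          ≈⟨ solve 4 (λ μ e w g →
               (μ :* μ) :* ((e :* (e :* (e :* (e :* (e :* con 1)))) :* w) :* g) :=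
               ((e :* (e :* g)) :* (μ :* (e :* (e :* e)))) :* (μ :* w)) A.refl μ E W generating ⟩
        ((E ⊛ (E ⊛ generating)) ⊛ (μ ⊛ (E ⊛ (E ⊛ E)))) ⊛ (μ ⊛ W)
          ≈⟨ A.*-congʳ (A.*-cong theta-equation jacobi-equation) ⟩
        (theta ⊛ jacobi) ⊛ (μ ⊛ W) ∎
        where
        open SetoidReasoning A.setoid
        open SemiringSolver commutativeSemiring using (solve; con; _:*_; _:=_)

      Not4 Multiple5 : ℕ → Set
      Not4 i      = i % 5 ≢ 4
      Multiple5 i = i % 5 ≡ 0

      const^-supported : ∀ a k → Supported (_≡ 0) (const a ^ k)
      const^-supported a k = supported-≋ (const-^ a k) (supported-const _)

      monomial-supported : ∀ a k e → Supported (_≡ e) (const a ^ k ⊛ X ^ e)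
      monomial-supported a k e = supported-* {f = const a ^ k} {g = X ^ e} (ℕ._≟ 0)
        (λ { ≡.refl eq → eq }) (const^-supported a k) (supported-X^ e)

      product-supported : Supported Not4 (theta ⊛ jacobi)
      product-supported = supported-≋ (A.sym expand)
        (supported-∑ (N ℕ.+ suc N) _ λ k l k+l →
          supported-∑ (suc N ℕ.+ suc N) _ λ i _ _ → term k l i k+l)
        where
        t = shifted (suc N)
        θ : ℕ → ℕ → Series
        θ k l = (const x ^ k ⊛ X ^ t k) ⊛ (const y ^ l ⊛ X ^ t l)
        ι : ℕ → Series
        ι i = X ^ t i ⊛ ((3 ℕ.+ i) ×ᴬ m ^ suc (3 ℕ.+ i))

        expand : (theta ⊛ jacobi) ≋
                 A∑.∑ (N ℕ.+ suc N) (λ k l → A∑.∑ (suc N ℕ.+ suc N) (λ i _ → θ k l ⊛ ι i))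
        expand = A.trans (A∑.∑-*ʳ (N ℕ.+ suc N) {θ} jacobi)
          (A∑.∑-cong (N ℕ.+ suc N) λ k l _ → A∑.∑-*ˡ (suc N ℕ.+ suc N) {λ i _ → ι i} (θ k l))

        θ-supported : ∀ k l → Supported (_≡ t k ℕ.+ t l) (θ k l)
        θ-supported k l = supported-* {f = const x ^ k ⊛ X ^ t k} {g = const y ^ l ⊛ X ^ t l}
          (ℕ._≟ t k) (≡.cong₂ ℕ._+_) (monomial-supported x k (t k)) (monomial-supported y l (t l))

        ι-supported : ∀ i → Supported (_≡ t i) (ι i)
        ι-supported i = supported-* {f = X ^ t i} {g = (3 ℕ.+ i) ×ᴬ m ^ suc (3 ℕ.+ i)} (ℕ._≟ t i)
          (λ { ≡.refl ≡.refl → ℕₚ.+-identityʳ _ }) (supported-X^ (t i))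
          (supported-× (3 ℕ.+ i) {m ^ suc (3 ℕ.+ i)} (const^-supported _ (suc (3 ℕ.+ i))))

        -- Either 5 divides 3 + i and the coefficient is zero in characteristic 5, or the quadratic
        -- obstruction keeps the exponent away from 4.
        term : ∀ k l i → k ℕ.+ l ≡ N ℕ.+ suc N → Supported Not4 (θ k l ⊛ ι i)
        term k l i k+l with (3 ℕ.+ i) % 5 ℕ.≟ 0
        ... | yes i≡2 = supported-≋ (A.sym (A.trans
                (A.*-congˡ (A.trans (A.*-congˡ
                  (Characteristic5.×-vanishes commutativeSemiring fiveᴬ (3 ℕ.+ i) (m ^ suc (3 ℕ.+ i)) i≡2))
                  (A.zeroʳ (X ^ t i))))
                (A.zeroʳ (θ k l)))) supported-0
        ... | no i≢2 = supported-⊆ {f = θ k l ⊛ ι i}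
                (λ { ≡.refl → exponent-residue K N k l i ≡.refl k+l i≢2 })
                (supported-* {U = _≡ t k ℕ.+ t l ℕ.+ t i} {f = θ k l} {g = ι i} (ℕ._≟ (t k ℕ.+ t l))
                  (≡.cong₂ ℕ._+_) (θ-supported k l) (ι-supported i))

      multiple5-+ : ∀ {i j} → Multiple5 i → Multiple5 j → Multiple5 (i ℕ.+ j)
      multiple5-+ {i} {j} p q =
        ≡.trans (%-distribˡ-+ i j 5) (≡.cong₂ (λ a b → (a ℕ.+ b) % 5) p q)

      cofactor-supported : Supported Multiple5 (μ ⊛ W)
      cofactor-supported = supported-* {f = μ} {g = W} (ℕ._≟ 0) (λ { ≡.refl q → q })
        (const^-supported _ (3 ℕ.+ N)) (∏-supported K)
        where
        factor : ℕ → Series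
        factor i = Euler.geometric commutativeSemiring K (X ^ (suc i ℕ.* 5))

        power-supported : ∀ i k → Supported Multiple5 ((X ^ (suc i ℕ.* 5)) ^ k)
        power-supported i k = supported-≋ (A.sym (^-assocʳ X (suc i ℕ.* 5) k))
          (supported-⊆ {f = X ^ (suc i ℕ.* 5 ℕ.* k)} (λ { ≡.refl → ≡.trans
              (≡.cong (_% 5) (≡.trans (ℕₚ.*-assoc (suc i) 5 k)
                (≡.trans (≡.cong (suc i ℕ.*_) (ℕₚ.*-comm 5 k)) (≡.sym (ℕₚ.*-assoc (suc i) k 5)))))
              (m*n%n≡0 (suc i ℕ.* k) 5) })
            (supported-X^ (suc i ℕ.* 5 ℕ.* k)))

        geometric-supported : ∀ i k →
          Supported Multiple5 (Euler.geometric commutativeSemiring k (X ^ (suc i ℕ.* 5)))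
        geometric-supported i zero    = supported-0
        geometric-supported i (suc k) = supported-+
          {f = Euler.geometric commutativeSemiring k (X ^ (suc i ℕ.* 5))}
          {g = (X ^ (suc i ℕ.* 5)) ^ k} (geometric-supported i k) (power-supported i k)

        ∏-supported : ∀ k → Supported Multiple5 (∏ k factor)
        ∏-supported zero    = supported-⊆ {f = const 1#} (λ { ≡.refl → ≡.refl }) (supported-const 1#)
        ∏-supported (suc k) = supported-* {f = ∏ k factor} {g = factor k} (λ i → i % 5 ℕ.≟ 0)
          (λ {i} {j} → multiple5-+ {i} {j}) (∏-supported k) (geometric-supported k K)

      generating-supported : Supported Not4 generating
      generating-supported = supported-≋ (A.sym generating-factors)
        (supported-* {f = theta ⊛ jacobi} {g = μ ⊛ W} not4?
          (λ {i} {j} → not4-+ {i} {j}) product-supported cofactor-supported)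
        where
        not4? : ∀ i → Dec (Not4 i)
        not4? i = ¬? (i % 5 ℕ.≟ 4)
        not4-+ : ∀ {i j} → Not4 i → Multiple5 j → Not4 (i ℕ.+ j)
        not4-+ {i} {j} i≢4 j≡0 eq = i≢4 (≡.trans (≡.sym (≡.trans (%-distribˡ-+ i j 5)
          (≡.trans (≡.cong (λ r → (i % 5 ℕ.+ r) % 5) j≡0)
            (≡.trans (≡.cong (_% 5) (ℕₚ.+-identityʳ (i % 5))) (m%n%n≡m%n i 5))))) eq)

      -- The predicate is arbitrary up to equivalence with the weight condition, because the one
      -- filtered by in `arrays` is an anonymous pattern-matching lambda.
      series-coeff : ∀ {a p} {A : Set a} {P : A → Set p} (w : A → ℕ) (P? : ∀ z → Dec (P z)) →
                     (∀ z → P z → w z ≡ n) → (∀ z → w z ≡ n → P z) → ∀ l →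
                     series X w l n ≈ length (filter P? l) × 1#
      series-coeff w P? to from []      = R.refl
      series-coeff w P? to from (z ∷ l) with P? z
      ... | yes p = R.+-cong (≡.subst (λ e → (X ^ e) n ≈ 1#) (≡.sym (to z p)) (X^-coeff-≡ n))
                             (series-coeff w P? to from l)
      ... | no ¬p = R.trans (R.+-cong (X^-coeff-≢ (w z) n λ eq → ¬p (from z eq))
                                      (series-coeff w P? to from l))
                            (R.+-identityˡ _)

      weight : List ℕ ⊗ List ℕ → ℕ
      weight (t , b) = length t ℕ.+ sum t ℕ.+ sum b

      candidates : List (List ℕ ⊗ List ℕ)
      candidates = concatMap (λ k → concatMap (λ t → map (t ,_) (rowsBelow K (suc k))) (rowsBelow K k)) (upTo K)

      -- Two ranges are enlarged at no cost modulo q^K: that of the entries, since values from K on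
      -- vanish, and that of the top length, since a top row of k entries has weight at least k.
      candidates-series : series X weight candidates ≋ generating
      candidates-series = series-applyUpTo X weight
        (λ k → concatMap (λ t → map (t ,_) (rowsBelow K (suc k))) (rowsBelow K k)) id K (N ℕ.+ suc N)
        (ℕₚ.≤-trans (ℕₚ.m≤n+m K K) (ℕₚ.≤-trans 2K≤1+N (ℕₚ.m≤m+n (suc N) (suc N))))
        (λ k → top (suc N) k ⊛ bottom (suc N) (suc k))
        (λ k _ → A.trans
          (series-pairs X weight (topWeight X) sum (λ _ _ → ≡.refl) (rowsBelow K k) (rowsBelow K (suc k)))
          (A.sym (A.*-cong (stable (λ V → top V k) (λ d → Top.rowSeries-stable X K X^K≋0 d k))
                           (stable (λ V → bottom V (suc k)) (λ d → Bottom.rowSeries-stable X K X^K≋0 d (suc k))))))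
        (λ k K≤k → A.trans (A.*-congʳ (A.trans (topSeries-bottomSeries X (suc N) k)
          (A.trans (A.*-congʳ (Euler.^-vanishes commutativeSemiring X K X^K≋0 K≤k)) (A.zeroˡ _))))
          (A.zeroˡ _))
        where
        stable : ∀ (r : ℕ → Series) → (∀ d → r (d ℕ.+ K) ≋ r K) → r (suc N) ≋ r K
        stable r r-stable = ≡.subst (λ V → r V ≋ r K)
          (ℕₚ.m∸n+n≡m (ℕₚ.m≤n⇒m≤1+n K≤N)) (r-stable (suc N ℕ.∸ K))

    count-vanishes : n % 5 ≡ 4 → phi2m1 n × 1# ≈ 0#
    count-vanishes n≡4 = begin
      phi2m1 n × 1#
        ≈⟨ series-coeff weight _ (λ _ p → p) (λ _ p → p) candidates ⟨
      series X weight candidates n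
        ≈⟨ coeff candidates-series n (ℕₚ.n<1+n n) ⟩
      generating n
        ≈⟨ generating-supported n (ℕₚ.n<1+n n) (λ n≢4 → n≢4 n≡4) ⟩
      0# ∎
      where open SetoidReasoning R.setoid

open import Data.Nat using (ℕ; _+_; _*_)

theorem5 : (n : ℕ) → 5 ∣ phi2m1 (5 * n + 4)
theorem5 n = m%n≡0⇒n∣m (phi2m1 (5 * n + 4)) 5
  (≡.trans (≡.cong (_% 5) (≡.sym (Mod5.×₅-proj₁ (phi2m1 (5 * n + 4)))))
    (Mod5.fst (Congruence.count-vanishes Mod5.commutativeSemiring (≡.refl Mod5., ≡.refl)
      -- These are x and 1 - x, the two roots of t² - t + 1.
      (0 , 1) (1 , 4) (≡.refl Mod5., ≡.refl) (≡.refl Mod5., ≡.refl) (5 * n + 4) residue≡4)))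
  where
  residue≡4 : (5 * n + 4) % 5 ≡ 4
  residue≡4 = ≡.trans (≡.cong (_% 5) (≡.trans (ℕₚ.+-comm (5 * n) 4) (≡.cong (4 +_) (ℕₚ.*-comm 5 n))))
    ([m+kn]%n≡m%n 4 n 5)
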